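{- There exists $n_0$ such that for all $n\ge n_0$ the following holds. There is a nonempty set $A\subseteq\left\{\left\lfloor\frac12\left(n+\sqrt{3n-4}\right)\right\rfloor,\left\lceil\frac12\left(n+\sqrt{3n-4}\right)\right\rceil\right\}$ such that, for all $a\in A$, every red-blue $K_n$ has at most \[3\left(a\binom{n-a}{3}+(n-a)\binom{a}{3}\right)=\frac{1}{16}n^4+O(n^3)\] $RRBB$-cycles. Moreover, this is achieved if and only if the edges of one colour form a complete bipartite graph $K_{a,n-a}$ on all $n$ vertices for some $a\in A$.
   Context: A red-blue $K_n$ is a complete graph on $n$ vertices each of whose edges is coloured red or blue. An $RRBB$-cycle is a $4$-cycle (counted as a subgraph) in which exactly two edges are red and these two red edges share a vertex (so the colours in cyclic order are red, red, blue, blue). -}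

module Defs where

open import Data.Nat using (ℕ; zero; suc; _+_; _*_; _∸_; _≤_; _<_; _≤ᵇ_; _≡ᵇ_)
open import Data.Nat.DivMod using (_/_)
open import Data.Nat.Combinatorics using (_C_)
open import Data.Fin using (Fin; toℕ)
open import Data.Bool using (Bool; true; false; if_then_else_)
open import Data.List using (List; map; allFin)
open import Data.Nat.ListAction using (sum)
open import Data.Product using (Σ; ∃; _×_)
open import Relation.Binary.PropositionalEquality using (_≡_; _≢_)
open import Relation.Nullary using (¬_; Dec; yes; no)
open import Data.Fin using (_≟_; _<?_)

-- A red-blue K_n: a symmetric colouring of pairs; true = red, false = blue.
-- (Values on the diagonal are irrelevant.)
Colouring : ℕ → Set
Colouring n = Fin n → Fin n → Bool

Symmetric : ∀ {n} → Colouring n → Set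
Symmetric {n} c = (i j : Fin n) → c i j ≡ c j i

private
  search : ℕ → ℕ → ℕ
  search m zero = zero
  search m (suc k) = if suc k * suc k ≤ᵇ m then suc k else search m k

floorSqrt : ℕ → ℕ
floorSqrt m = search m m

ceilSqrt : ℕ → ℕ
ceilSqrt m = if floorSqrt m * floorSqrt m ≡ᵇ m then floorSqrt m else suc (floorSqrt m)

-- ⌊ (n + √(3n-4)) / 2 ⌋ = ⌊ (n + ⌊√(3n-4)⌋) / 2 ⌋
lowA : ℕ → ℕ
lowA n = (n + floorSqrt (3 * n ∸ 4)) / 2

-- ⌈ (n + √(3n-4)) / 2 ⌉ = ⌈ (n + ⌈√(3n-4)⌉) / 2 ⌉ = ⌊ (n + ⌈√(3n-4)⌉ + 1) / 2 ⌋
highA : ℕ → ℕ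
highA n = (n + ceilSqrt (3 * n ∸ 4) + 1) / 2

bound : ℕ → ℕ → ℕ
bound n a = 3 * (a * ((n ∸ a) C 3) + (n ∸ a) * (a C 3))

private
  ⌊_⌋ᵇ : ∀ {P : Set} → Dec P → ℕ
  ⌊ yes _ ⌋ᵇ = 1
  ⌊ no _ ⌋ᵇ = 0

  distinct? : ∀ {n} → Fin n → Fin n → Bool
  distinct? i j with i ≟ j
  ... | yes _ = false
  ... | no _ = true

  _∧_ : Bool → Bool → Bool
  true ∧ b = b
  false ∧ b = false
  infixr 6 _∧_

  not : Bool → Bool
  not true = false
  not false = true

  lt? : ∀ {n} → Fin n → Fin n → Bool
  lt? i j with i <? j
  ... | yes _ = true
  ... | no _ = false

  toN : Bool → ℕ
  toN true = 1
  toN false = 0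

-- (v0,v1,v2,v3) spans an RRBB 4-cycle v0-v1-v2-v3-v0 with red edges v0v1, v1v2
-- and blue edges v2v3, v3v0.  Every RRBB 4-cycle (as a subgraph) arises from
-- exactly two such labelled tuples (swap v0 and v2); we normalise by v0 < v2.
isRRBB : ∀ {n} → Colouring n → Fin n → Fin n → Fin n → Fin n → Bool
isRRBB c v0 v1 v2 v3 =
  lt? v0 v2 ∧ distinct? v0 v1 ∧ distinct? v0 v3 ∧ distinct? v1 v2 ∧
  distinct? v1 v3 ∧ distinct? v2 v3 ∧
  c v0 v1 ∧ c v1 v2 ∧ not (c v2 v3) ∧ not (c v3 v0)

rrbbCount : ∀ {n} → Colouring n → ℕ
rrbbCount {n} c =
  sum (map (λ v0 → sum (map (λ v1 → sum (map (λ v2 → sum (map (λ v3 →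
    toN (isRRBB c v0 v1 v2 v3)) (allFin n))) (allFin n))) (allFin n))) (allFin n))

sideSize : ∀ {n} → (Fin n → Bool) → ℕ
sideSize {n} S = sum (map (λ i → toN (S i)) (allFin n))

OneColourBipartite : ∀ {n} → Colouring n → ℕ → Set
OneColourBipartite {n} c a =
  Σ Bool λ b → Σ (Fin n → Bool) λ S → (sideSize S ≡ a) ×
    ((i j : Fin n) → i ≢ j → (c i j ≡ b → S i ≢ S j) × (S i ≢ S j → c i j ≡ b))

{-# OPTIONS --safe #-}

-- Fix a colour d and let σ be the symmetric sign matrix with σ i j = 1 iff i = j
-- or ij has colour d. The number of RRBB-cycles is a sum over pairs of vertices
-- of (common red neighbours) × (common blue neighbours), which expands into an
-- exact formula in n, tr σ³, tr σ⁴ and the row sums of σ. If σ = s sᵀ, i.e. if the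
-- other colour is complete bipartite, the formula depends on u = (Σ s)² only and is
-- a quadratic with maximum at u = 3n - 4.
--
-- For the general case choose d with tr σ³ ≥ 0. Then n (n³ - tr σ³) ≤ 3 (n⁴ - tr σ⁴),
-- and by averaging some row x of σ satisfies n Y ≤ n³ - tr σ³, where Y is the ℓ¹
-- distance from σ to the rank one matrix of row x. Replacing σ by this matrix
-- loses at least n² Y / 6 in the trace terms, whereas the remaining terms change
-- by only O(n + |Σ σ| + Y) Y. So for large n the count lies strictly below the
-- bipartite one unless Y = 0; if |Σ σ| or Y is of order n², the count is small anyway.
module Submission where

open import Defs
open import Algebra.Bundles using (CommutativeRing)
open import Algebra.Structures using (IsCommutativeRing)
import Algebra.Solver.Ring
import Algebra.Solver.Ring.AlmostCommutativeRing as ACR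
open import Data.Bool using (Bool; true; false; not; if_then_else_; T)
import Data.Bool as Bool
import Data.Bool.Properties as Boolₚ
open import Data.Fin using (Fin; zero; suc)
import Data.Fin as Fin
import Data.Fin.Properties as Finₚ
open import Data.Integer using (ℤ; +_; +[1+_]; -[1+_]; _≤_; _<_; +≤+; -≤+; +<+; 0ℤ; 1ℤ; -1ℤ)
import Data.Integer as ℤ
import Data.Integer.Properties as ℤₚ
open import Data.List using (List; []; _∷_; allFin; tabulate)
import Data.List as List
import Data.List.Properties as Listₚ
open import Data.Maybe using (Maybe; just; is-just)
open import Data.Nat as ℕ using (ℕ; zero; suc; z≤n; s≤s; _∸_; _≤ᵇ_; _≡ᵇ_)
open import Data.Nat.Combinatorics using (_C_; nCk+nC[k+1]≡[n+1]C[k+1]; nC1≡n)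
import Data.Nat.DivMod as DivMod
import Data.Nat.ListAction as ListAction
import Data.Nat.Properties as ℕₚ
open import Data.Product using (Σ; ∃; _×_; _,_; proj₁; proj₂)
open import Data.Sum using (_⊎_; inj₁; inj₂)
open import Data.Vec using (Vec; []; _∷_)
import Data.Vec as Vec
open import Data.Vec.N-ary using (N-ary; _$ⁿ_)
open import Function.Bundles using (_⇔_; mk⇔)
open import Level using (0ℓ)
open import Relation.Binary.Definitions using (Tri; tri<; tri≈; tri>)
open import Relation.Binary.PropositionalEquality
open import Relation.Nullary using (Dec; yes; no; does)
open import Relation.Nullary.Decidable using (dec⇒maybe; dec-true; dec-false)
open import Relation.Nullary.Negation using (contradiction)

-- Integer arithmetic

-- The obstacle is that `θ = n³ - tr σ³` enters the count as `+ 4 θ`: a deviation from rank one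
-- raises this term, so `β = n⁴ - tr σ⁴` has to outweigh it by a factor of order `n`. Four-cycles by
-- themselves only see the square of `tr σ³`: they give `3 n² β ≥ n⁶ - (tr σ³)² = θ (n³ + tr σ³)`,
-- which is void near `tr σ³ = - n³`. This is why the sign of `tr σ³` decides which colour is used.
-- Approximating by a row of σ, rather than by an eigenvector, keeps everything integral. The row is
-- a sign vector, so `profile n u` is the excess of an actual bipartite colouring, and the remaining
-- optimisation runs over integer part sizes. Moreover `Y` is an integer, so `Y ≠ 0` already means
-- `Y ≥ 1`; this turns an approximate stability statement into exact uniqueness. The threshold
-- 100000 is a round number. The strictest polynomial inequality, met when `S` is positive of order
-- `n²`, is in essence `12 n⁴ > 444672 n³`, that is `n > 37056`.

infixl 6 _+_ _-_
infixl 7 _*_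
infix 8 -_

-- Opaque, because conversion checking would otherwise unfold the integer
-- operations to signs and absolute values, which is exponential in the size
-- of a polynomial expression.
opaque
  _+_ _*_ : ℤ → ℤ → ℤ
  _+_ = ℤ._+_
  _*_ = ℤ._*_

  -_ : ℤ → ℤ
  -_ = ℤ.-_

_-_ : ℤ → ℤ → ℤ
a - b = a + - b

opaque
  unfolding _+_

  isCommutativeRing : IsCommutativeRing _≡_ _+_ _*_ -_ 0ℤ 1ℤ
  isCommutativeRing = ℤₚ.+-*-isCommutativeRing

  +-mono-≤ : ∀ {a b c d} → a ≤ b → c ≤ d → a + c ≤ b + d
  +-mono-≤ = ℤₚ.+-mono-≤

  +-mono-≤-< : ∀ {a b c d} → a ≤ b → c < d → a + c < b + d
  +-mono-≤-< = ℤₚ.+-mono-≤-<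

  *-nonneg : ∀ {a b} → 0ℤ ≤ a → 0ℤ ≤ b → 0ℤ ≤ a * b
  *-nonneg {+ a} {+ b} _ _ = subst (0ℤ ≤_) (ℤₚ.pos-* a b) (+≤+ z≤n)

  square : ∀ a → 0ℤ ≤ a * a
  square (+ a) = *-nonneg {+ a} {+ a} (+≤+ z≤n) (+≤+ z≤n)
  square -[1+ a ] = +≤+ z≤n

  ≤⇒0≤- : ∀ {a b} → a ≤ b → 0ℤ ≤ b - a
  ≤⇒0≤- = ℤₚ.i≤j⇒0≤j-i

  0≤-⇒≤ : ∀ {a b} → 0ℤ ≤ b - a → a ≤ b
  0≤-⇒≤ = ℤₚ.0≤i-j⇒j≤i

  <⇒1+≤ : ∀ {a b} → a < b → 1ℤ + a ≤ b
  <⇒1+≤ = ℤₚ.i<j⇒suc[i]≤j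

  0<-⇒< : ∀ {a b} → 0ℤ < b - a → a < b
  0<-⇒< {a} {b} 0<b-a = subst₂ _<_ (ℤₚ.+-identityˡ a)
    (trans (ℤₚ.+-assoc b (ℤ.- a) a) (trans (cong (ℤ._+_ b) (ℤₚ.+-inverseˡ a)) (ℤₚ.+-identityʳ b)))
    (ℤₚ.+-monoˡ-< a 0<b-a)

  *-cancel-≤ : ∀ {a b} k → +[1+ k ] * a ≤ +[1+ k ] * b → a ≤ b
  *-cancel-≤ {a} {b} k = ℤₚ.*-cancelˡ-≤-pos a b +[1+ k ]

  *-cancel-< : ∀ {a b} k → +[1+ k ] * a < +[1+ k ] * b → a < b
  *-cancel-< k = ℤₚ.*-cancelˡ-<-nonNeg +[1+ k ]

  *-cancel-≡ : ∀ {a b} k → +[1+ k ] * a ≡ +[1+ k ] * b → a ≡ b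
  *-cancel-≡ {a} {b} k = ℤₚ.*-cancelˡ-≡ +[1+ k ] a b

  pos-+ : ∀ m n → + (m ℕ.+ n) ≡ + m + + n
  pos-+ = ℤₚ.pos-+

  pos-* : ∀ m n → + (m ℕ.* n) ≡ + m * + n
  pos-* = ℤₚ.pos-*

ℤ-ring : CommutativeRing 0ℓ 0ℓ
ℤ-ring = record { isCommutativeRing = isCommutativeRing }

coefficients : ℤ.+-*-rawRing ACR.-Raw-AlmostCommutative⟶ ACR.fromCommutativeRing ℤ-ring
coefficients = record
    { ⟦_⟧ = λ z → z ; +-homo = +-homo ; *-homo = *-homo ; -‿homo = -‿homo
    ; 0-homo = refl ; 1-homo = refl }
  where
  opaque
    unfolding _+_
    +-homo : ∀ a b → a ℤ.+ b ≡ a + b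
    +-homo _ _ = refl
    *-homo : ∀ a b → a ℤ.* b ≡ a * b
    *-homo _ _ = refl
    -‿homo : ∀ a → ℤ.- a ≡ - a
    -‿homo _ = refl

open Algebra.Solver.Ring ℤ.+-*-rawRing (ACR.fromCommutativeRing ℤ-ring) coefficients (λ a b → dec⇒maybe (a ℤₚ.≟ b)) public
  using (Polynomial; con; var; _:+_; _:*_; _:-_; :-_; _:=_; ⟦_⟧; Normal; ⟦_⟧N; normalise; correct; _≟N_; _≈N_; ⟦_⟧N-cong)

#_ : ∀ {n} → ℕ → Polynomial n
# k = con (+ k)
infix 10 #_

private
  close : ∀ n → N-ary n (Polynomial n) (Polynomial n × Polynomial n) → Polynomial n × Polynomial n
  close n f = f $ⁿ Vec.map var (Vec.allFin n)

  sound : ∀ {n} {p q : Normal n} (m : Maybe (p ≈N q)) → T (is-just m) → ∀ ρ → ⟦ p ⟧N ρ ≡ ⟦ q ⟧N ρ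
  sound (just e) _ ρ = ⟦ e ⟧N-cong ρ

-- The normal forms are compared as closed data: comparing their denotations,
-- as the solver's own entry points do, is far too slow for the polynomials below.
ring : ∀ n (f : N-ary n (Polynomial n) (Polynomial n × Polynomial n)) (ρ : Vec ℤ n) →
  {T (is-just (normalise (proj₁ (close n f)) ≟N normalise (proj₂ (close n f))))} →
  ⟦ proj₁ (close n f) ⟧ ρ ≡ ⟦ proj₂ (close n f) ⟧ ρ
ring n f ρ {t} = trans (sym (correct p ρ)) (trans (sound (normalise p ≟N normalise q) t ρ) (correct q ρ))
  where
  p = proj₁ (close n f)
  q = proj₂ (close n f)

infixl 6 _⊕_
infixl 7 _⊗_

_⊕_ : ∀ {a b} → 0ℤ ≤ a → 0ℤ ≤ b → 0ℤ ≤ a + b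
_⊕_ {a} {b} p q = subst (_≤ a + b) (CommutativeRing.+-identityˡ ℤ-ring 0ℤ) (+-mono-≤ p q)

_⊗_ : ∀ {a b} → 0ℤ ≤ a → 0ℤ ≤ b → 0ℤ ≤ a * b
_⊗_ = *-nonneg

<⇒0≤ : ∀ {a b} → a < b → 0ℤ ≤ b - a - 1ℤ
<⇒0≤ {a} {b} a<b = subst (0ℤ ≤_) (ring 2 (λ a b → b :- (# 1 :+ a) := b :- a :- # 1) (a ∷ b ∷ [])) (≤⇒0≤- (<⇒1+≤ a<b))

lit : ∀ k → 0ℤ ≤ + k
lit k = +≤+ z≤n

-- Inequalities are proved by certificates: `c` is a sum of products of quantities known to be
-- nonnegative, assembled with `_⊕_` and `_⊗_`, and a polynomial identity equates it with the
-- difference of the two sides.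
certify-≤ : ∀ {a b c} → 0ℤ ≤ c → c ≡ b - a → a ≤ b
certify-≤ p eq = 0≤-⇒≤ (subst (0ℤ ≤_) eq p)

certify-< : ∀ {a b c} k → 0ℤ ≤ c → c + +[1+ k ] ≡ b - a → a < b
certify-< k p eq = 0<-⇒< (subst₂ _<_ (CommutativeRing.+-identityˡ ℤ-ring 0ℤ) eq (+-mono-≤-< p (+<+ (s≤s z≤n))))

+-≡ : ∀ {a b c d : ℤ} → a ≡ b → c ≡ d → a + c ≡ b + d
+-≡ = cong₂ _+_

pos-suc : ∀ n → + suc n ≡ 1ℤ + + n
pos-suc n = pos-+ 1 n

-- The analytic estimate

-- The number of RRBB-cycles, multiplied by 32, is leading n + excess n β θ Z S, where
-- β = n⁴ - tr σ⁴, θ = n³ - tr σ³, and Z and S are the sums of the squares of the row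
-- sums of σ and of the row sums; profile n u is the excess for σ = s sᵀ, u = (Σ s)².
excess : (n β θ Z S : ℤ) → ℤ
excess n β θ Z S = - β + + 4 * θ + + 8 * Z - + 2 * S * S + (+ 4 * n - + 16) * S

profile : (n u : ℤ) → ℤ
profile n u = - (+ 2 * u * u) + (+ 12 * n - + 16) * u

leading : ℤ → ℤ
leading n = + 2 * n * n * n * n - + 12 * n * n * n + + 16 * n * n

gap : ∀ {n} → + 100000 ≤ n → ∀ k → {T (k ℕ.≤ᵇ 100000)} → 0ℤ ≤ n - + k
gap large k {k≤} = ≤⇒0≤- (ℤₚ.≤-trans (+≤+ (ℕₚ.≤ᵇ⇒≤ k 100000 k≤)) large)

-- Here - β + 4 θ ≤ - n² Y / 6 absorbs the error of replacing S by u and Z by n u,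
-- unless |S| or Y is of order n²; then - 2 S² or - β makes the excess negative.
module Estimate (n : ℤ) (n-large : + 100000 ≤ n) (β θ Z S u Y : ℤ)
  (nθ≤3β : n * θ ≤ + 3 * β) (nY≤θ : n * Y ≤ θ) (0≤Y : 0ℤ ≤ Y)
  (Z≤ : Z ≤ n * u + + 2 * n * Y) (S-u≤Y : S - u ≤ Y) (u-S≤Y : u - S ≤ Y) where

  private
    G = excess n β θ Z S

    0≤n : 0ℤ ≤ n
    0≤n = ℤₚ.≤-trans (lit 100000) n-large

    0≤θ : 0ℤ ≤ θ
    0≤θ = ℤₚ.≤-trans (0≤n ⊗ 0≤Y) nY≤θ

    -- Of the two copies of `n θ` supplied by `6 β ≥ 2 n θ`, one absorbs `24 θ` because `n ≥ 24`,
    -- and the other is at least `n² Y`.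
    excess≤ : + 6 * G ≤ - (n * n * Y) + + 48 * Z - + 12 * S * S + + 24 * n * S - + 96 * S
    excess≤ = certify-≤ (lit 2 ⊗ ≤⇒0≤- nθ≤3β ⊕ gap n-large 24 ⊗ 0≤θ ⊕ 0≤n ⊗ ≤⇒0≤- nY≤θ)
      (ring 6 (λ n β θ Z S Y →
        # 2 :* (# 3 :* β :- n :* θ) :+ (n :- # 24) :* θ :+ n :* (θ :- n :* Y) := (:- (n :* n :* Y) :+ # 48
          :* Z :- # 12 :* S :* S :+ # 24 :* n :* S :- # 96 :* S) :- # 6 :* (:- β :+ # 4 :* θ :+ # 8 :* Z :-
          # 2 :* S :* S :+ (# 4 :* n :- # 16) :* S))
        (n ∷ β ∷ θ ∷ Z ∷ S ∷ Y ∷ []))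

    -- Completing the square in `S` bounds `288 G` by `- n⁴ + 2304 n³ + 576 (n - 4)²`; the factor is
    -- `6 * 48`, with 48 clearing the denominator in `Y ≥ n² / 48`.
    excess<0-Y : Z ≤ n * n * n → n * n ≤ + 48 * Y → G < 0ℤ
    excess<0-Y Z≤n³ h = *-cancel-< 287 (certify-< 4607
      (lit 48 ⊗ ≤⇒0≤- excess≤ ⊕ 0≤n ⊗ 0≤n ⊗ ≤⇒0≤- h ⊕ lit 2304 ⊗ ≤⇒0≤- Z≤n³ ⊕ lit 576 ⊗ square (S - n + + 4)
        ⊕ 0≤n ⊗ 0≤n ⊗ 0≤n ⊗ gap n-large 100000 ⊕ lit 97696 ⊗ 0≤n ⊗ 0≤n ⊗ gap n-large 1
        ⊕ lit 97120 ⊗ 0≤n ⊗ 0≤n ⊕ lit 4608 ⊗ gap n-large 3)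
      (ring 5 (λ n Z S Y G →
        # 48 :* (:- (n :* n :* Y) :+ # 48 :* Z :- # 12 :* S :* S :+ # 24 :* n :* S :- # 96 :* S :- # 6 :* G)
          :+ n :* n :* (# 48 :* Y :- n :* n) :+ # 2304 :* (n :* n :* n :- Z) :+ # 576 :* ((S :- n :+ # 4) :*
          (S :- n :+ # 4)) :+ n :* n :* n :* (n :- # 100000) :+ # 97696 :* n :* n :* (n :- # 1) :+ # 97120
          :* n :* n :+ # 4608 :* (n :- # 3) :+ # 4608 := # 288 :* # 0 :- # 288 :* G)
        (n ∷ Z ∷ S ∷ Y ∷ G ∷ [])))

    -- Put `w = 96 S ≥ n²` and scale by `96² = 9216`. The terms in `S` become
    -- `- 12 w² + 2304 n w - 9216 w`, which decrease for `w ≥ n²`; at `w = n²` the term `- 12 n⁴`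
    -- has to beat `2304 n³` together with `9216 * 48 n³` from `Z`.
    excess<0-S : Z ≤ n * n * n → n * n ≤ + 96 * S → G < 0ℤ
    excess<0-S Z≤n³ h = *-cancel-< 55295 (certify-< 0
      (lit 9216 ⊗ (≤⇒0≤- excess≤ ⊕ 0≤n ⊗ 0≤n ⊗ 0≤Y ⊕ lit 48 ⊗ ≤⇒0≤- Z≤n³ ⊕ ≤⇒0≤- h ⊕ 0≤n ⊗ 0≤n)
        ⊕ lit 12 ⊗ ≤⇒0≤- h ⊗ (0≤n ⊗ gap n-large 192 ⊕ 0≤n ⊗ 0≤n ⊕ ≤⇒0≤- h)
        ⊕ lit 12 ⊗ 0≤n ⊗ 0≤n ⊗ 0≤n ⊗ gap n-large 37057
        ⊕ (lit 12 ⊗ 0≤n ⊗ 0≤n ⊕ lit 12 ⊗ 0≤n ⊕ lit 12) ⊗ gap n-large 1 ⊕ lit 11)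
      (ring 5 (λ n Z S Y G →
        # 9216 :* ((:- (n :* n :* Y) :+ # 48 :* Z :- # 12 :* S :* S :+ # 24 :* n :* S :- # 96 :* S :- # 6 :*
          G) :+ n :* n :* Y :+ # 48 :* (n :* n :* n :- Z) :+ (# 96 :* S :- n :* n) :+ n :* n) :+ # 12 :*
          (# 96 :* S :- n :* n) :* (n :* (n :- # 192) :+ n :* n :+ (# 96 :* S :- n :* n)) :+ # 12 :* n :* n :*
          n :* (n :- # 37057) :+ (# 12 :* n :* n :+ # 12 :* n :+ # 12) :* (n :- # 1) :+ # 11 :+ # 1 :=
          # 55296 :* # 0 :- # 55296 :* G)
        (n ∷ Z ∷ S ∷ Y ∷ G ∷ [])))

    -- For negative `S` the linear terms in `S` also lower the excess, since `n ≥ 4`; only `48 n³`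
    -- from `Z` has to be beaten by the square of `S`.
    excess<0-neg-S : Z ≤ n * n * n → n * n ≤ - (+ 96 * S) → G < 0ℤ
    excess<0-neg-S Z≤n³ h = *-cancel-< 55295 (certify-< 0
      (lit 9216 ⊗ (≤⇒0≤- excess≤ ⊕ 0≤n ⊗ 0≤n ⊗ 0≤Y ⊕ lit 48 ⊗ ≤⇒0≤- Z≤n³)
        ⊕ lit 2304 ⊗ gap n-large 4 ⊗ (≤⇒0≤- h ⊕ 0≤n ⊗ 0≤n)
        ⊕ lit 12 ⊗ ≤⇒0≤- h ⊗ (lit 2 ⊗ 0≤n ⊗ 0≤n ⊕ ≤⇒0≤- h)
        ⊕ lit 12 ⊗ 0≤n ⊗ 0≤n ⊗ 0≤n ⊗ gap n-large 36865
        ⊕ (lit 12 ⊗ 0≤n ⊗ 0≤n ⊕ lit 12 ⊗ 0≤n ⊕ lit 12) ⊗ gap n-large 1 ⊕ lit 11)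
      (ring 5 (λ n Z S Y G →
        # 9216 :* ((:- (n :* n :* Y) :+ # 48 :* Z :- # 12 :* S :* S :+ # 24 :* n :* S :- # 96 :* S :- # 6 :*
          G) :+ n :* n :* Y :+ # 48 :* (n :* n :* n :- Z)) :+ # 2304 :* (n :- # 4) :* (:- (# 96 :* S) :- n
          :* n :+ n :* n) :+ # 12 :* (:- (# 96 :* S) :- n :* n) :* (# 2 :* n :* n :+ (:- (# 96 :* S) :- n :*
          n)) :+ # 12 :* n :* n :* n :* (n :- # 36865) :+ (# 12 :* n :* n :+ # 12 :* n :+ # 12) :* (n :-
          # 1) :+ # 11 :+ # 1 := # 55296 :* # 0 :- # 55296 :* G)
        (n ∷ Z ∷ S ∷ Y ∷ G ∷ [])))

    -- After scaling by 48 the gain is `8 n² Y`. Replacing `S²` by `u²` costs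
    -- `96 (u - S)² + 192 S (u - S)` up to sign, and the cut-offs `n² / 48` for `Y` and `n² / 96`
    -- for `|S|` are chosen so that each of the two terms costs at most `2 n² Y`. The linear errors
    -- are of order `n Y` and fit into the remaining `4 n² Y` when `n ≥ 240`.
    excess<profile-small : 1ℤ ≤ Y → + 48 * Y ≤ n * n → + 96 * S ≤ n * n → - (+ 96 * S) ≤ n * n → G < profile n u
    excess<profile-small 1≤Y hY hS hS′ = *-cancel-< 47 (certify-< 767
      (lit 8 ⊗ ≤⇒0≤- excess≤ ⊕ lit 384 ⊗ ≤⇒0≤- Z≤ ⊕ lit 96 ⊗ (≤⇒0≤- u-S≤Y ⊗ ≤⇒0≤- S-u≤Y)
        ⊕ lit 2 ⊗ 0≤Y ⊗ ≤⇒0≤- hY ⊕ ≤⇒0≤- hS ⊗ ≤⇒0≤- S-u≤Y ⊕ ≤⇒0≤- hS′ ⊗ ≤⇒0≤- u-S≤Y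
        ⊕ lit 192 ⊗ gap n-large 4 ⊗ ≤⇒0≤- S-u≤Y
        ⊕ lit 4 ⊗ 0≤n ⊗ 0≤Y ⊗ gap n-large 240 ⊕ lit 768 ⊗ ≤⇒0≤- 1≤Y)
      (ring 6 (λ n Z S u Y G →
        # 8 :* (:- (n :* n :* Y) :+ # 48 :* Z :- # 12 :* S :* S :+ # 24 :* n :* S :- # 96 :* S :- # 6 :* G)
          :+ # 384 :* (n :* u :+ # 2 :* n :* Y :- Z) :+ # 96 :* ((Y :- (u :- S)) :* (Y :- (S :- u))) :+ # 2
          :* Y :* (n :* n :- # 48 :* Y) :+ (n :* n :- # 96 :* S) :* (Y :- (S :- u)) :+ (n :* n :- :- (# 96
          :* S)) :* (Y :- (u :- S)) :+ # 192 :* (n :- # 4) :* (Y :- (S :- u)) :+ # 4 :* n :* Y :* (n :-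
          # 240) :+ # 768 :* (Y :- # 1) :+ # 768 := # 48 :* (:- (# 2 :* u :* u) :+ (# 12 :* n :- # 16) :* u)
          :- # 48 :* G)
        (n ∷ Z ∷ S ∷ u ∷ Y ∷ G ∷ [])))

  excess<profile : Z ≤ n * n * n → 1ℤ ≤ Y → G < 0ℤ ⊎ G < profile n u
  excess<profile Z≤n³ 1≤Y with ℤₚ.≤-total (n * n) (+ 48 * Y) | ℤₚ.≤-total (n * n) (+ 96 * S) | ℤₚ.≤-total (n * n) (- (+ 96 * S))
  ... | inj₁ h | _ | _ = inj₁ (excess<0-Y Z≤n³ h)
  ... | inj₂ _ | inj₁ h | _ = inj₁ (excess<0-S Z≤n³ h)
  ... | inj₂ _ | inj₂ _ | inj₁ h = inj₁ (excess<0-neg-S Z≤n³ h)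
  ... | inj₂ hY | inj₂ hS | inj₂ hS′ = inj₂ (excess<profile-small 1≤Y hY hS hS′)

-- Finite sums

import Algebra.Properties.Semiring.Sum (CommutativeRing.semiring ℤ-ring) as Sum

opaque
  sum : ∀ {n} → (Fin n → ℤ) → ℤ
  sum = Sum.sum

  sum-cong : ∀ {n} {f g : Fin n → ℤ} → (∀ i → f i ≡ g i) → sum f ≡ sum g
  sum-cong = Sum.sum-cong-≗

  sum-+ : ∀ {n} (f g : Fin n → ℤ) → sum (λ i → f i + g i) ≡ sum f + sum g
  sum-+ = Sum.∑-distrib-+

  sum-comm : ∀ {m n} (f : Fin m → Fin n → ℤ) → sum (λ i → sum (λ j → f i j)) ≡ sum (λ j → sum (λ i → f i j))
  sum-comm = Sum.∑-comm

  sum-*ˡ : ∀ {n} a (f : Fin n → ℤ) → sum (λ i → a * f i) ≡ a * sum f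
  sum-*ˡ a f = sym (Sum.*-distribˡ-sum a f)

  sum-*ʳ : ∀ {n} a (f : Fin n → ℤ) → sum (λ i → f i * a) ≡ sum f * a
  sum-*ʳ a f = sym (Sum.*-distribʳ-sum a f)

  sum-zero : (f : Fin 0 → ℤ) → sum f ≡ 0ℤ
  sum-zero f = refl

  sum-suc : ∀ {n} (f : Fin (suc n) → ℤ) → sum f ≡ f zero + sum (λ i → f (suc i))
  sum-suc f = refl

  sum-const : ∀ n a → sum {n} (λ _ → a) ≡ + n * a
  sum-const zero a = ring 1 (λ a → # 0 := # 0 :* a) (a ∷ [])
  sum-const (suc n) a = trans (+-≡ refl (sum-const n a))
    (trans (ring 2 (λ a n → a :+ n :* a := (# 1 :+ n) :* a) (a ∷ + n ∷ [])) (cong (_* a) (sym (pos-suc n))))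

  sum-mono : ∀ {n} {f g : Fin n → ℤ} → (∀ i → f i ≤ g i) → sum f ≤ sum g
  sum-mono {zero} f≤g = +≤+ z≤n
  sum-mono {suc n} f≤g = +-mono-≤ (f≤g zero) (sum-mono (λ i → f≤g (suc i)))

  sum-nonneg : ∀ {n} {f : Fin n → ℤ} → (∀ i → 0ℤ ≤ f i) → 0ℤ ≤ sum f
  sum-nonneg {zero} 0≤f = +≤+ z≤n
  sum-nonneg {suc n} 0≤f = 0≤f zero ⊕ sum-nonneg (λ i → 0≤f (suc i))

  term≤sum : ∀ {n} {f : Fin n → ℤ} → (∀ i → 0ℤ ≤ f i) → ∀ i → f i ≤ sum f
  term≤sum {f = f} 0≤f zero = certify-≤ (sum-nonneg (λ i → 0≤f (suc i)))
    (ring 2 (λ a b → b := a :+ b :- a) (f zero ∷ sum (λ i → f (suc i)) ∷ []))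
  term≤sum {f = f} 0≤f (suc i) = certify-≤ (0≤f zero ⊕ ≤⇒0≤- (term≤sum (λ i → 0≤f (suc i)) i))
    (ring 3 (λ a b c → a :+ (b :- c) := a :+ b :- c) (f zero ∷ sum (λ i → f (suc i)) ∷ f (suc i) ∷ []))

minimiser : ∀ {n} (f : Fin (suc n) → ℤ) → ∃ λ i → ∀ j → f i ≤ f j
minimiser {zero} f = zero , λ { zero → ℤₚ.≤-refl }
minimiser {suc n} f with minimiser (λ i → f (suc i))
... | i , min with ℤₚ.≤-total (f zero) (f (suc i))
...   | inj₁ f₀≤ = zero , λ { zero → ℤₚ.≤-refl ; (suc j) → ℤₚ.≤-trans f₀≤ (min j) }
...   | inj₂ ≤f₀ = suc i , λ { zero → ≤f₀ ; (suc j) → min j }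

below-average : ∀ {n} (f : Fin (suc n) → ℤ) → ∃ λ i → +[1+ n ] * f i ≤ sum f
below-average {n} f with minimiser f
... | i , min = i , subst (_≤ sum f) (sum-const (suc n) (f i)) (sum-mono min)

-- Linear combinations of functions as data. Once `ring` has put a summand into this shape
-- pointwise, the sum is distributed over all its terms in one step, and each basic sum can then be
-- evaluated separately.
Combination : Set → Set
Combination A = List (ℤ × (A → ℤ))

⟪_⟫ : ∀ {A} → Combination A → A → ℤ
⟪ [] ⟫ a = 0ℤ
⟪ (k , f) ∷ L ⟫ a = k * f a + ⟪ L ⟫ a

apply : ∀ {A} → ((A → ℤ) → ℤ) → Combination A → ℤ
apply Φ [] = 0ℤ
apply Φ ((k , f) ∷ L) = k * Φ f + apply Φ L

sum-combination : ∀ {n} (L : Combination (Fin n)) → sum ⟪ L ⟫ ≡ apply sum L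
sum-combination {n} [] = trans (sum-const n 0ℤ) (ring 1 (λ n → n :* # 0 := # 0) (+ n ∷ []))
sum-combination ((k , f) ∷ L) = trans (sum-+ (λ i → k * f i) ⟪ L ⟫) (+-≡ (sum-*ˡ k f) (sum-combination L))

sum-minus : ∀ {n} (f g : Fin n → ℤ) → sum (λ i → f i - g i) ≡ sum f - sum g
sum-minus f g = trans (sum-cong λ i → cong (λ z → f i + z) (negate (g i)))
  (trans (sum-+ f _) (cong (λ z → sum f + z) (trans (sum-*ˡ -1ℤ g) (sym (negate (sum g))))))
  where
  negate : ∀ a → - a ≡ -1ℤ * a
  negate a = ring 1 (λ a → :- a := con -1ℤ :* a) (a ∷ [])

sum₂ : ∀ {n} → (Fin n × Fin n → ℤ) → ℤ
sum₂ f = sum λ i → sum λ j → f (i , j)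

sum₂-cong : ∀ {n} {f g : Fin n × Fin n → ℤ} → (∀ p → f p ≡ g p) → sum₂ f ≡ sum₂ g
sum₂-cong f≗g = sum-cong λ i → sum-cong λ j → f≗g (i , j)

sum₂-combination : ∀ {n} (L : Combination (Fin n × Fin n)) → sum₂ ⟪ L ⟫ ≡ apply sum₂ L
sum₂-combination {n} [] = trans (sum-cong λ _ → sum-combination {n} []) (sum-combination {n} [])
sum₂-combination ((k , f) ∷ L) = trans
  (sum-cong λ i → trans (sum-+ (λ j → k * f (i , j)) (λ j → ⟪ L ⟫ (i , j))) (+-≡ (sum-*ˡ k _) refl))
  (trans (sum-+ (λ i → k * sum (λ j → f (i , j))) _) (+-≡ (sum-*ˡ k _) (sum₂-combination L)))

-- Signs and the Kronecker delta

data IsSign : ℤ → Set where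
  plus  : IsSign 1ℤ
  minus : IsSign -1ℤ

opaque
  unfolding _+_

  sign-* : ∀ {a b} → IsSign a → IsSign b → IsSign (a * b)
  sign-* plus plus = plus
  sign-* plus minus = minus
  sign-* minus plus = minus
  sign-* minus minus = plus

  sign-neg : ∀ {a} → IsSign a → IsSign (- a)
  sign-neg plus = minus
  sign-neg minus = plus

  sign-square : ∀ {a} → IsSign a → a * a ≡ 1ℤ
  sign-square plus = refl
  sign-square minus = refl

  sign-≤1 : ∀ {a} → IsSign a → a ≤ 1ℤ
  sign-≤1 plus = ℤₚ.≤-refl
  sign-≤1 minus = -≤+

  -- Equivalent to `1 - a b c ≤ (1 - a) + (1 - b) + (1 - c)`: a product of signs is negative only if
  -- some factor is. Every comparison of σ with a rank one matrix, and of triangles with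
  -- four-cycles, comes from this inequality.
  sign-union-bound : ∀ {a b c} → IsSign a → IsSign b → IsSign c → a + b + c ≤ + 2 + a * b * c
  sign-union-bound plus plus plus = ℤₚ.≤-refl
  sign-union-bound plus plus minus = ℤₚ.≤-refl
  sign-union-bound plus minus plus = ℤₚ.≤-refl
  sign-union-bound plus minus minus = -≤+
  sign-union-bound minus plus plus = ℤₚ.≤-refl
  sign-union-bound minus plus minus = -≤+
  sign-union-bound minus minus plus = -≤+
  sign-union-bound minus minus minus = -≤+

sign-union-bound₂ : ∀ {a b} → IsSign a → IsSign b → a + b ≤ 1ℤ + a * b
sign-union-bound₂ {a} {b} sa sb = certify-≤ (≤⇒0≤- (sign-union-bound sa sb plus))
  (ring 2 (λ a b → # 2 :+ a :* b :* # 1 :- (a :+ b :+ # 1) := # 1 :+ a :* b :- (a :+ b)) (a ∷ b ∷ []))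

kronecker : ∀ {n} → Fin n → Fin n → ℤ
kronecker i j with i Fin.≟ j
... | yes _ = 1ℤ
... | no _ = 0ℤ

kronecker-refl : ∀ {n} (i : Fin n) → kronecker i i ≡ 1ℤ
kronecker-refl i with i Fin.≟ i
... | yes _ = refl
... | no i≢i = contradiction refl i≢i

kronecker-off : ∀ {n} {i j : Fin n} → i ≢ j → kronecker i j ≡ 0ℤ
kronecker-off {i = i} {j} i≢j with i Fin.≟ j
... | yes i≡j = contradiction i≡j i≢j
... | no _ = refl

kronecker-suc : ∀ {n} (i j : Fin n) → kronecker (suc i) (suc j) ≡ kronecker i j
kronecker-suc i j with i Fin.≟ j
... | yes _ = refl
... | no _ = refl

sum-kronecker : ∀ {n} (i : Fin n) (f : Fin n → ℤ) → sum (λ j → kronecker i j * f j) ≡ f i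
sum-kronecker {suc n} zero f = trans (sum-suc _) (trans (+-≡ refl (trans (sum-cong λ j → ring 1 (λ a → # 0 :* a := # 0) (f (suc j) ∷ [])) (sum-combination {n} [])))
  (ring 1 (λ a → # 1 :* a :+ # 0 := a) (f zero ∷ [])))
sum-kronecker {suc n} (suc i) f = trans (sum-suc _) (trans (+-≡ refl (trans (sum-cong λ j → cong (_* f (suc j)) (kronecker-suc i j)) (sum-kronecker i (λ j → f (suc j)))))
  (ring 2 (λ a b → # 0 :* a :+ b := b) (f zero ∷ f (suc i) ∷ [])))

-- Sign matrices

module SignMatrix {n : ℕ} (σ : Fin n → Fin n → ℤ) (σ-sign : ∀ i j → IsSign (σ i j)) (σ-sym : ∀ i j → σ i j ≡ σ j i) where

  N = + n

  deg : Fin n → ℤ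
  deg i = sum λ j → σ i j

  total squares triangles cycles : ℤ
  total = sum deg
  squares = sum λ i → deg i * deg i
  triangles = sum λ i → sum λ j → sum λ k → σ i j * σ j k * σ k i
  cycles = sum λ i → sum λ j → sum λ k → sum λ l → σ i j * σ j l * σ l k * σ k i

  private
    τ : Fin n → Fin n → Fin n → ℤ
    τ i j k = σ i j * σ j k * σ k i

    e : Fin n → Fin n → Fin n → Fin n → ℤ
    e i j k l = σ i j * σ j l * σ l k * σ k i

    τ-sign : ∀ i j k → IsSign (τ i j k)
    τ-sign i j k = sign-* (sign-* (σ-sign i j) (σ-sign j k)) (σ-sign k i)

    e-sign : ∀ i j k l → IsSign (e i j k l)
    e-sign i j k l = sign-* (sign-* (sign-* (σ-sign i j) (σ-sign j l)) (σ-sign l k)) (σ-sign k i)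

    σσ : ∀ i j → σ i j * σ j i ≡ 1ℤ
    σσ i j = trans (cong (σ i j *_) (σ-sym j i)) (sign-square (σ-sign i j))

    sum₃-const : ∀ a → sum {n} (λ x → sum {n} λ y → sum {n} λ z → a) ≡ N * (N * (N * a))
    sum₃-const a = trans (sum-cong λ x → trans (sum-cong λ y → sum-const n a) (sum-const n _)) (sum-const n _)

  deg-square : ∀ i → deg i * deg i ≡ sum λ j → sum λ k → σ i j * σ i k
  deg-square i = sym (trans (sum-cong λ j → sum-*ˡ (σ i j) (σ i)) (sum-*ʳ (deg i) (σ i)))

  column : ∀ j → sum (λ i → σ i j) ≡ deg j
  column j = sum-cong λ i → σ-sym i j

  -- Moving from one triple of vertices to another one vertex at a time, each
  -- change of the sign of the triangle is witnessed by a negative four-cycle.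
  triangles-vs-cycles : + 3 * (N * N * cycles) ≤ + 2 * (N * N * N * N * N * N) + triangles * triangles
  triangles-vs-cycles = subst₂ _≤_ lhs rhs
    (sum-mono λ x → sum-mono λ y → sum-mono λ z → sum-mono λ x′ → sum-mono λ y′ → sum-mono λ z′ → step x y z x′ y′ z′)
    where
    step : ∀ x y z x′ y′ z′ → e x y z x′ + e y z x′ y′ + e z x′ y′ z′ ≤ + 2 + τ x y z * τ x′ y′ z′
    step x y z x′ y′ z′ = subst (λ p → e x y z x′ + e y z x′ y′ + e z x′ y′ z′ ≤ + 2 + p) product
      (sign-union-bound (e-sign x y z x′) (e-sign y z x′ y′) (e-sign z x′ y′ z′))
      where
      -- Each four-cycle is the product of two consecutive triangles of the strip `xyz`, `yzx′`,
      -- `zx′y′`, `x′y′z′`. In the product of the three four-cycles the edges `yx′`, `x′z` and `zy′`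
      -- occur twice and cancel, leaving the two end triangles.
      product : e x y z x′ * e y z x′ y′ * e z x′ y′ z′ ≡ τ x y z * τ x′ y′ z′
      product = trans
        (ring 12 (λ xy yx′ x′z zx yz zy′ y′x′ x′y zx′ x′z′ z′y′ y′z →
            (xy :* yx′ :* x′z :* zx) :* (yz :* zy′ :* y′x′ :* x′y) :* (zx′ :* x′z′ :* z′y′ :* y′z)
            := (xy :* yz :* zx) :* (y′x′ :* z′y′ :* x′z′) :* ((yx′ :* x′y) :* (x′z :* zx′) :* (zy′ :* y′z)))
          (σ x y ∷ σ y x′ ∷ σ x′ z ∷ σ z x ∷ σ y z ∷ σ z y′ ∷ σ y′ x′ ∷ σ x′ y ∷ σ z x′ ∷ σ x′ z′ ∷ σ z′ y′ ∷ σ y′ z ∷ []))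
        (trans (cong₂ (λ p q → τ x y z * p * q)
          (cong₂ _*_ (cong₂ _*_ (σ-sym y′ x′) (σ-sym z′ y′)) (σ-sym x′ z′))
          (cong₂ _*_ (cong₂ _*_ (σσ y x′) (σσ x′ z)) (σσ z y′)))
          (ring 2 (λ p q → p :* q :* (# 1 :* # 1 :* # 1) := p :* q) (τ x y z ∷ τ x′ y′ z′ ∷ [])))

    *-sum₃ : ∀ a (f : Fin n → Fin n → Fin n → ℤ) →
      sum (λ x → sum λ y → sum λ z → a * f x y z) ≡ a * sum (λ x → sum λ y → sum λ z → f x y z)
    *-sum₃ a f = trans (sum-cong λ x → trans (sum-cong λ y → sum-*ˡ a (f x y)) (sum-*ˡ a λ y → sum (f x y)))
      (sum-*ˡ a λ x → sum λ y → sum (f x y))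

    +-sum₃ : ∀ (f g : Fin n → Fin n → Fin n → ℤ) → sum (λ x → sum λ y → sum λ z → f x y z + g x y z)
      ≡ sum (λ x → sum λ y → sum λ z → f x y z) + sum (λ x → sum λ y → sum λ z → g x y z)
    +-sum₃ f g = trans (sum-cong λ x → trans (sum-cong λ y → sum-+ (f x y) (g x y)) (sum-+ (λ y → sum (f x y)) λ y → sum (g x y)))
      (sum-+ (λ x → sum λ y → sum (f x y)) λ x → sum λ y → sum (g x y))

    *-sum₄ : ∀ a (f : Fin n → Fin n → Fin n → Fin n → ℤ) → sum (λ x → sum λ y → sum λ z → sum λ w → a * f x y z w)
      ≡ a * sum (λ x → sum λ y → sum λ z → sum λ w → f x y z w)
    *-sum₄ a f = trans (sum-cong λ x → *-sum₃ a (f x)) (sum-*ˡ a λ x → sum λ y → sum λ z → sum (f x y z))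

    first : sum (λ x → sum λ y → sum λ z → sum λ x′ → sum {n} λ y′ → sum {n} λ z′ → e x y z x′) ≡ N * (N * cycles)
    first = trans (sum-cong λ x → sum-cong λ y → sum-cong λ z → sum-cong λ x′ → trans (sum-cong λ y′ → sum-const n _) (sum-const n _))
      (trans (*-sum₄ N _) (cong (N *_) (*-sum₄ N e)))

    second : sum {n} (λ x → sum λ y → sum λ z → sum λ x′ → sum λ y′ → sum {n} λ z′ → e y z x′ y′) ≡ N * (N * cycles)
    second = trans (sum-const n _) (cong (N *_) (trans (sum-cong λ y → sum-cong λ z → sum-cong λ x′ → sum-cong λ y′ → sum-const n _) (*-sum₄ N e)))

    third : sum {n} (λ x → sum {n} λ y → sum λ z → sum λ x′ → sum λ y′ → sum λ z′ → e z x′ y′ z′) ≡ N * (N * cycles)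
    third = trans (sum-const n _) (cong (N *_) (sum-const n _))

    +-sum₆ : ∀ (f g : Fin n → Fin n → Fin n → Fin n → Fin n → Fin n → ℤ) →
      sum (λ x → sum λ y → sum λ z → sum λ x′ → sum λ y′ → sum λ z′ → f x y z x′ y′ z′ + g x y z x′ y′ z′)
      ≡ sum (λ x → sum λ y → sum λ z → sum λ x′ → sum λ y′ → sum λ z′ → f x y z x′ y′ z′)
        + sum (λ x → sum λ y → sum λ z → sum λ x′ → sum λ y′ → sum λ z′ → g x y z x′ y′ z′)
    +-sum₆ f g = trans (sum-cong λ x → sum-cong λ y → sum-cong λ z → +-sum₃ (f x y z) (g x y z)) (+-sum₃ _ _)

    lhs : sum (λ x → sum λ y → sum λ z → sum λ x′ → sum λ y′ → sum λ z′ → e x y z x′ + e y z x′ y′ + e z x′ y′ z′)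
      ≡ + 3 * (N * N * cycles)
    lhs = trans (+-sum₆ _ _) (trans (+-≡ (trans (+-sum₆ _ _) (+-≡ first second)) third)
      (ring 2 (λ n q → n :* (n :* q) :+ n :* (n :* q) :+ n :* (n :* q) := # 3 :* (n :* n :* q)) (N ∷ cycles ∷ [])))

    rhs : sum (λ x → sum λ y → sum λ z → sum λ x′ → sum λ y′ → sum λ z′ → + 2 + τ x y z * τ x′ y′ z′)
      ≡ + 2 * (N * N * N * N * N * N) + triangles * triangles
    rhs = trans (+-sum₆ _ _) (+-≡
      (trans (sum-cong λ x → sum-cong λ y → sum-cong λ z → sum₃-const (+ 2)) (trans (sum₃-const _)
        (ring 1 (λ n → n :* (n :* (n :* (n :* (n :* (n :* # 2))))) := # 2 :* (n :* n :* n :* n :* n :* n)) (N ∷ []))))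
      (trans (sum-cong λ x → sum-cong λ y → trans (sum-cong λ z → *-sum₃ (τ x y z) τ) (sum-*ʳ triangles (τ x y)))
        (trans (sum-cong λ x → sum-*ʳ triangles λ y → sum (τ x y)) (sum-*ʳ triangles λ x → sum λ y → sum (τ x y)))))

  module Pivot (x : Fin n) where

    -- This is `|σ u v - ω u v|`, written through the sign of the triangle `x u v`. In this form it
    -- is linear in that sign, so that summing over the pivot `x` as well gives exactly
    -- `N³ - triangles`.
    η : Fin n → Fin n → ℤ
    η u v = 1ℤ - σ x u * σ u v * σ v x

    defect : ℤ
    defect = sum λ u → sum λ v → η u v

    η-nonneg : ∀ u v → 0ℤ ≤ η u v
    η-nonneg u v = ≤⇒0≤- (sign-≤1 (τ-sign x u v))

    defect-nonneg : 0ℤ ≤ defect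
    defect-nonneg = sum-nonneg λ u → sum-nonneg λ v → η-nonneg u v

    ω : Fin n → Fin n → ℤ
    ω u v = σ x u * σ x v

    ω-sign : ∀ u v → IsSign (ω u v)
    ω-sign u v = sign-* (σ-sign x u) (σ-sign x v)

    -- The factor `1 - η` is itself a sign. The deviation from rank one is thus multiplicative, and
    -- the union bounds turn it into additive errors.
    split : ∀ u v → σ u v ≡ ω u v * (1ℤ - η u v)
    split u v = sym (trans (ring 4 (λ a b c d → a :* b :* (# 1 :- (# 1 :- a :* c :* d)) := (a :* a) :* (b :* d) :* c)
        (σ x u ∷ σ x v ∷ σ u v ∷ σ v x ∷ []))
      (trans (cong₂ (λ p q → p * q * σ u v) (sign-square (σ-sign x u)) (σσ x v))
        (ring 1 (λ c → # 1 :* # 1 :* c := c) (σ u v ∷ []))))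

    1-η-sign : ∀ u v → IsSign (1ℤ - η u v)
    1-η-sign u v = subst IsSign (ring 1 (λ t → t := # 1 :- (# 1 :- t)) (τ x u v ∷ [])) (τ-sign x u v)

    ω-total : sum (λ u → sum λ v → ω u v) ≡ deg x * deg x
    ω-total = sym (deg-square x)

    -- The union bound for two signs is applied to `- ω` here and to `ω` in `total≥`; this bounds
    -- the change of the total in both directions.
    total≤ : total - deg x * deg x ≤ defect
    total≤ = certify-≤ (≤⇒0≤- estimate) (ring 3 (λ t y s → (t :+ y) :- s := y :- (s :- t)) (deg x * deg x ∷ defect ∷ total ∷ []))
      where
      pointwise : ∀ u v → σ u v ≤ ω u v + η u v
      pointwise u v = certify-≤ (≤⇒0≤- (sign-union-bound₂ (sign-neg (ω-sign u v)) (1-η-sign u v)))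
        (trans (ring 2 (λ w h → # 1 :+ :- w :* (# 1 :- h) :- (:- w :+ (# 1 :- h)) := (w :+ h) :- w :* (# 1 :- h)) (ω u v ∷ η u v ∷ []))
          (cong (λ p → ω u v + η u v - p) (sym (split u v))))
      estimate : total ≤ deg x * deg x + defect
      estimate = subst (total ≤_)
        (trans (trans (sum-cong λ u → sum-+ (ω u) (η u)) (sum-+ _ _)) (+-≡ ω-total refl))
        (sum-mono λ u → sum-mono λ v → pointwise u v)

    total≥ : deg x * deg x - total ≤ defect
    total≥ = certify-≤ (≤⇒0≤- estimate) (ring 3 (λ t y s → (s :+ y) :- t := y :- (t :- s)) (deg x * deg x ∷ defect ∷ total ∷ []))
      where
      pointwise : ∀ u v → ω u v ≤ σ u v + η u v
      pointwise u v = certify-≤ (≤⇒0≤- (sign-union-bound₂ (ω-sign u v) (1-η-sign u v)))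
        (trans (ring 2 (λ w h → # 1 :+ w :* (# 1 :- h) :- (w :+ (# 1 :- h)) := w :* (# 1 :- h) :+ h :- w) (ω u v ∷ η u v ∷ []))
          (cong (λ p → p + η u v - ω u v) (sym (split u v))))
      estimate : deg x * deg x ≤ total + defect
      estimate = subst₂ _≤_ ω-total
        (trans (sum-cong λ u → sum-+ (σ u) (η u)) (sum-+ _ _))
        (sum-mono λ u → sum-mono λ v → pointwise u v)

    -- In `σ v u * σ v w` the pivot sign of the middle vertex `v` cancels, so the product is `ω u w`
    -- up to the two flips at `v u` and `v w`. Each flip costs `N * defect` after summation over the
    -- free third vertex.
    squares≤ : squares ≤ N * (deg x * deg x) + + 2 * N * defect
    squares≤ = subst₂ _≤_ (sum-cong λ v → sym (deg-square v)) rhs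
      (sum-mono λ v → sum-mono λ u → sum-mono λ w → pointwise v u w)
      where
      pointwise : ∀ v u w → σ v u * σ v w ≤ ω u w + (η v u + η v w)
      pointwise v u w = certify-≤ (≤⇒0≤- (sign-union-bound (sign-neg (ω-sign u w)) (1-η-sign v u) (1-η-sign v w)))
        (trans (ring 3 (λ o h k → # 2 :+ :- o :* (# 1 :- h) :* (# 1 :- k) :- (:- o :+ (# 1 :- h) :+ (# 1 :- k))
            := o :+ (h :+ k) :- o :* (# 1 :- h) :* (# 1 :- k)) (ω u w ∷ η v u ∷ η v w ∷ []))
          (cong (λ p → ω u w + (η v u + η v w) - p) (sym eq)))
        where
        eq : σ v u * σ v w ≡ ω u w * (1ℤ - η v u) * (1ℤ - η v w)
        eq = trans (cong₂ _*_ (split v u) (split v w))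
          (trans (ring 5 (λ a b c h k → (a :* b :* h) :* (a :* c :* k) := (a :* a) :* ((b :* c) :* h :* k))
              (σ x v ∷ σ x u ∷ σ x w ∷ 1ℤ - η v u ∷ 1ℤ - η v w ∷ []))
            (trans (cong (_* (ω u w * (1ℤ - η v u) * (1ℤ - η v w))) (sign-square (σ-sign x v))) (ring 1 (λ a → # 1 :* a := a) (_ ∷ []))))
      rhs : sum (λ v → sum λ u → sum λ w → ω u w + (η v u + η v w)) ≡ N * (deg x * deg x) + + 2 * N * defect
      rhs = trans
        (trans (sum-cong λ v → trans (sum-cong λ u → trans (sum-+ (ω u) _) (+-≡ refl (trans (sum-+ _ (η v)) (+-≡ (sum-const n (η v u)) refl))))
            (trans (sum-+ _ _) (+-≡ ω-total (trans (sum-+ _ _) (+-≡ (sum-*ˡ N (η v)) (sum-const n (sum (η v))))))))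
          (trans (sum-+ _ _) (+-≡ (sum-const n _) (trans (sum-+ _ _) (+-≡ (sum-*ˡ N _) (sum-*ˡ N _))))))
        (ring 3 (λ n t y → n :* t :+ (n :* y :+ n :* y) := n :* t :+ # 2 :* n :* y) (N ∷ deg x * deg x ∷ defect ∷ []))

  squares≤N³ : squares ≤ N * N * N
  squares≤N³ = subst₂ _≤_ (sum-cong λ v → sym (deg-square v))
    (trans (sum-cong λ v → trans (sum-cong λ u → sum-const n _) (sum-const n _)) (trans (sum-const n _)
      (ring 1 (λ n → n :* (n :* (n :* # 1)) := n :* n :* n) (N ∷ []))))
    (sum-mono λ v → sum-mono λ u → sum-mono λ w → sign-≤1 (sign-* (σ-sign v u) (σ-sign v w)))

  defect-sum : sum Pivot.defect ≡ N * N * N - triangles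
  defect-sum = trans
    (sum-cong λ x → trans (sum-cong λ u → sum-minus (λ _ → 1ℤ) (τ x u)) (sum-minus (λ _ → sum (λ _ → 1ℤ)) λ u → sum (τ x u)))
    (trans (sum-minus (λ _ → sum (λ _ → sum (λ _ → 1ℤ))) _) (cong (λ z → z - triangles)
      (trans (sum₃-const 1ℤ) (ring 1 (λ n → n :* (n :* (n :* # 1)) := n :* n :* n) (N ∷ [])))))

  -- Along a closed walk every vertex sign appears squared, so both traces take their largest
  -- possible values and the terms `β` and `θ` vanish. What is left is `excess` at `Z = N u` and
  -- `S = u`.
  rank-one-excess : (s : Fin n → ℤ) → (∀ i → IsSign (s i)) → (∀ i j → σ i j ≡ s i * s j) →
    excess N (N * N * N * N - cycles) (N * N * N - triangles) squares total ≡ profile N (sum s * sum s)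
  rank-one-excess s s-sign σ≡ = trans
    (cong₂ (λ q t → excess N (N * N * N * N - q) (N * N * N - t) squares total) cycles≡ triangles≡)
    (trans (cong₂ (excess N (N * N * N * N - N * (N * (N * (N * 1ℤ)))) (N * N * N - N * (N * (N * 1ℤ)))) squares≡ total≡)
    (ring 2 (λ n u → :- (n :* n :* n :* n :- n :* (n :* (n :* (n :* # 1)))) :+ # 4 :* (n :* n :* n :- n :* (n :* (n :* # 1)))
      :+ # 8 :* (n :* u) :- # 2 :* u :* u :+ (# 4 :* n :- # 16) :* u := :- (# 2 :* u :* u) :+ (# 12 :* n :- # 16) :* u) (N ∷ Σs * Σs ∷ [])))
    where
    Σs = sum s

    s² : ∀ i → s i * s i ≡ 1ℤ
    s² i = sign-square (s-sign i)

    deg≡ : ∀ i → deg i ≡ s i * Σs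
    deg≡ i = trans (sum-cong (σ≡ i)) (sum-*ˡ (s i) s)

    total≡ : total ≡ Σs * Σs
    total≡ = trans (sum-cong deg≡) (sum-*ʳ Σs s)

    squares≡ : squares ≡ N * (Σs * Σs)
    squares≡ = trans (sum-cong λ i → trans (cong₂ _*_ (deg≡ i) (deg≡ i))
      (trans (ring 2 (λ a t → a :* t :* (a :* t) := a :* a :* (t :* t)) (s i ∷ Σs ∷ []))
        (trans (cong (_* (Σs * Σs)) (s² i)) (ring 1 (λ t → # 1 :* t := t) (Σs * Σs ∷ []))))) (sum-const n (Σs * Σs))

    triangles≡ : triangles ≡ N * (N * (N * 1ℤ))
    triangles≡ = trans
      (sum-cong λ i → trans (sum-cong λ j → trans (sum-cong λ k →
        trans (cong₂ _*_ (cong₂ _*_ (σ≡ i j) (σ≡ j k)) (σ≡ k i))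
        (trans (ring 3 (λ a b c → a :* b :* (b :* c) :* (c :* a) := a :* a :* (b :* b) :* (c :* c)) (s i ∷ s j ∷ s k ∷ []))
        (trans (cong₂ _*_ (cong₂ _*_ (s² i) (s² j)) (s² k)) (ring 0 (# 1 :* # 1 :* # 1 := # 1) []))))
        (sum-const n 1ℤ)) (sum-const n _)) (sum-const n _)

    cycles≡ : cycles ≡ N * (N * (N * (N * 1ℤ)))
    cycles≡ = trans
      (sum-cong λ i → trans (sum-cong λ j → trans (sum-cong λ k → trans (sum-cong λ l →
        trans (cong₂ _*_ (cong₂ _*_ (cong₂ _*_ (σ≡ i j) (σ≡ j l)) (σ≡ l k)) (σ≡ k i))
        (trans (ring 4 (λ a b c d → a :* b :* (b :* d) :* (d :* c) :* (c :* a) := a :* a :* (b :* b) :* (c :* c) :* (d :* d)) (s i ∷ s j ∷ s k ∷ s l ∷ []))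
        (trans (cong₂ _*_ (cong₂ _*_ (cong₂ _*_ (s² i) (s² j)) (s² k)) (s² l)) (ring 0 (# 1 :* # 1 :* # 1 :* # 1 := # 1) []))))
        (sum-const n 1ℤ)) (sum-const n _)) (sum-const n _)) (sum-const n _)

-- The counting formula in terms of traces and row sums

common : ∀ {n} → (Fin n → Fin n → ℤ) → Fin n → Fin n → ℤ
common M x x′ = sum λ y → M x y * M x′ y

common-comm : ∀ {n} (M : Fin n → Fin n → ℤ) x x′ → common M x x′ ≡ common M x′ x
common-comm M x x′ = sum-cong λ y → CommutativeRing.*-comm ℤ-ring (M x y) (M x′ y)

module Expansion {n : ℕ} (σ : Fin n → Fin n → ℤ) (σ-sign : ∀ i j → IsSign (σ i j)) (σ-sym : ∀ i j → σ i j ≡ σ j i)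
  (σ-diag : ∀ i → σ i i ≡ 1ℤ) where

  open SignMatrix σ σ-sign σ-sym

  module _ (P Q : Fin n → Fin n → ℤ)
    (2P≡ : ∀ i j → + 2 * P i j ≡ 1ℤ + σ i j - + 2 * kronecker i j) (2Q≡ : ∀ i j → + 2 * Q i j ≡ 1ℤ - σ i j) where

    private
      q : Fin n → Fin n → ℤ
      q = common σ

      δ : Fin n → Fin n → ℤ
      δ = kronecker

      4*common : ∀ (M : Fin n → Fin n → ℤ) x x′ → + 4 * common M x x′ ≡ sum λ y → (+ 2 * M x y) * (+ 2 * M x′ y)
      4*common M x x′ = sym (trans
        (sum-cong λ y → ring 2 (λ a b → (# 2 :* a) :* (# 2 :* b) := # 4 :* (a :* b)) (M x y ∷ M x′ y ∷ []))
        (sum-*ˡ (+ 4) _))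

      -- The diagonal of σ is 1, which suits rank one matrices and makes `1 - σ` vanish on the
      -- diagonal. The price is paid by `P`, whose loops are removed by the Kronecker term; hence
      -- the extra terms compared with `common-Q`.
      common-P : ∀ x x′ → + 4 * common P x x′ ≡ N + deg x + deg x′ + q x x′ - + 4 - + 4 * σ x x′ + + 4 * δ x x′
      common-P x x′ = trans (4*common P x x′) (trans
        (sum-cong λ y → trans (cong₂ _*_ (2P≡ x y) (2P≡ x′ y))
          (ring 4 (λ s s′ d d′ → (# 1 :+ s :- # 2 :* d) :* (# 1 :+ s′ :- # 2 :* d′)
            := # 1 :* # 1 :+ (# 1 :* s :+ (# 1 :* s′ :+ (# 1 :* (s :* s′) :+
               (con -[1+ 1 ] :* (d :* (# 1 :+ s′)) :+ (con -[1+ 1 ] :* (d′ :* (# 1 :+ s)) :+ (# 4 :* (d′ :* d) :+ # 0)))))))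
            (σ x y ∷ σ x′ y ∷ δ x y ∷ δ x′ y ∷ [])))
        (trans (sum-combination
            ((1ℤ , λ _ → 1ℤ) ∷ (1ℤ , σ x) ∷ (1ℤ , σ x′) ∷ (1ℤ , λ y → σ x y * σ x′ y) ∷
             (-[1+ 1 ] , λ y → δ x y * (1ℤ + σ x′ y)) ∷ (-[1+ 1 ] , λ y → δ x′ y * (1ℤ + σ x y)) ∷ (+ 4 , λ y → δ x′ y * δ x y) ∷ []))
        (trans (+-≡ (cong (1ℤ *_) (sum-const n 1ℤ)) (+-≡ refl (+-≡ refl (+-≡ refl (+-≡ (cong (-[1+ 1 ] *_) (sum-kronecker x _))
            (+-≡ (cong (-[1+ 1 ] *_) (sum-kronecker x′ _)) (+-≡ (cong (+ 4 *_) (sum-kronecker x′ _)) refl)))))))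
        (trans (cong (λ s → 1ℤ * (N * 1ℤ) + (1ℤ * deg x + (1ℤ * deg x′ + (1ℤ * q x x′ +
              (-[1+ 1 ] * (1ℤ + s) + (-[1+ 1 ] * (1ℤ + σ x x′) + (+ 4 * δ x x′ + 0ℤ))))))) (σ-sym x′ x))
          (ring 6 (λ n d d′ q s e → # 1 :* (n :* # 1) :+ (# 1 :* d :+ (# 1 :* d′ :+ (# 1 :* q :+
              (con -[1+ 1 ] :* (# 1 :+ s) :+ (con -[1+ 1 ] :* (# 1 :+ s) :+ (# 4 :* e :+ # 0))))))
              := n :+ d :+ d′ :+ q :- # 4 :- # 4 :* s :+ # 4 :* e)
            (N ∷ deg x ∷ deg x′ ∷ q x x′ ∷ σ x x′ ∷ δ x x′ ∷ []))))))

      common-Q : ∀ x x′ → + 4 * common Q x x′ ≡ N - deg x - deg x′ + q x x′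
      common-Q x x′ = trans (4*common Q x x′) (trans
        (sum-cong λ y → trans (cong₂ _*_ (2Q≡ x y) (2Q≡ x′ y))
          (ring 2 (λ s s′ → (# 1 :- s) :* (# 1 :- s′) := # 1 :* # 1 :+ (con -1ℤ :* s :+ (con -1ℤ :* s′ :+ (# 1 :* (s :* s′) :+ # 0))))
            (σ x y ∷ σ x′ y ∷ [])))
        (trans (sum-combination ((1ℤ , λ _ → 1ℤ) ∷ (-1ℤ , σ x) ∷ (-1ℤ , σ x′) ∷ (1ℤ , λ y → σ x y * σ x′ y) ∷ []))
        (trans (+-≡ (cong (1ℤ *_) (sum-const n 1ℤ)) refl)
          (ring 4 (λ n d d′ q → # 1 :* (n :* # 1) :+ (con -1ℤ :* d :+ (con -1ℤ :* d′ :+ (# 1 :* q :+ # 0))) := n :- d :- d′ :+ q)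
            (N ∷ deg x ∷ deg x′ ∷ q x x′ ∷ [])))))

      q-diag : ∀ x → q x x ≡ N
      q-diag x = trans (sum-cong λ y → sign-square (σ-sign x y)) (trans (sum-const n 1ℤ) (ring 1 (λ n → n :* # 1 := n) (N ∷ [])))

      sum-q : sum (λ x → sum λ x′ → q x x′) ≡ squares
      sum-q = trans (sum-cong λ x → trans (sum-comm λ x′ y → σ x y * σ x′ y)
          (sum-cong λ y → trans (sum-*ˡ (σ x y) _) (cong (σ x y *_) (column y))))
        (trans (sum-comm λ x y → σ x y * deg y) (sum-cong λ y → trans (sum-*ʳ (deg y) _) (cong (_* deg y) (column y))))

      sum-qq : sum (λ x → sum λ x′ → q x x′ * q x x′) ≡ cycles
      sum-qq = trans
        (sum-cong λ x → trans
          (sum-cong λ x′ → trans (sym (sum-*ʳ (q x x′) _)) (sum-cong λ y → sym (sum-*ˡ (σ x y * σ x′ y) _)))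
          (trans (sum-comm λ x′ y → sum λ z → σ x y * σ x′ y * (σ x z * σ x′ z))
            (sum-cong λ y → sum-comm λ x′ z → σ x y * σ x′ y * (σ x z * σ x′ z))))
        (sum-cong λ x → sum-cong λ y → sum-cong λ z → sum-cong λ x′ →
          trans (ring 4 (λ a b c d → a :* b :* (c :* d) := a :* b :* d :* c) (σ x y ∷ σ x′ y ∷ σ x z ∷ σ x′ z ∷ []))
            (cong₂ (λ b c → σ x y * b * σ x′ z * c) (σ-sym x′ y) (σ-sym x z)))

      sum-σq : sum (λ x → sum λ x′ → σ x x′ * q x x′) ≡ triangles
      sum-σq = sum-cong λ x → sum-cong λ x′ → trans (sym (sum-*ˡ (σ x x′) _))
        (sum-cong λ y → trans (ring 3 (λ a b c → a :* (b :* c) := a :* c :* b) (σ x x′ ∷ σ x y ∷ σ x′ y ∷ []))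
          (cong (λ b → σ x x′ * σ x′ y * b) (σ-sym x y)))

      -- Here `q` is the matrix square of σ, so summing `q * q` gives the trace of σ⁴ and summing
      -- `σ * q` that of σ³. Every other product in the expansion factors through row sums, or
      -- collapses to the diagonal by the Kronecker delta.
      pairs : + 16 * sum (λ x → sum λ x′ → common P x x′ * common Q x x′)
        ≡ N * N * N * N + cycles - + 2 * total * total - + 4 * N * N * N + + 4 * N * total + + 4 * squares - + 4 * triangles
          + + 8 * N * N - + 8 * total
      pairs = trans (trans (sym (sum-*ˡ (+ 16) _)) (sum-cong λ x → sym (sum-*ˡ (+ 16) _)))
        (trans (sum₂-cong pointwise) (trans (sum₂-combination L) evaluated))
        where
        L : Combination (Fin n × Fin n)
        L = (N * N - + 4 * N , λ _ → 1ℤ)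
          ∷ (1ℤ , λ (x , x′) → q x x′ * q x x′)
          ∷ (+ 2 * N - + 4 , λ (x , x′) → q x x′)
          ∷ (-1ℤ , λ (x , x′) → deg x * deg x)
          ∷ (-1ℤ , λ (x , x′) → deg x′ * deg x′)
          ∷ (-[1+ 1 ] , λ (x , x′) → deg x * deg x′)
          ∷ (+ 4 , λ (x , x′) → deg x)
          ∷ (+ 4 , λ (x , x′) → deg x′)
          ∷ (- (+ 4 * N) , λ (x , x′) → σ x x′)
          ∷ (+ 4 , λ (x , x′) → σ x x′ * deg x)
          ∷ (+ 4 , λ (x , x′) → σ x x′ * deg x′)
          ∷ (-[1+ 3 ] , λ (x , x′) → σ x x′ * q x x′)
          ∷ (+ 4 , λ (x , x′) → δ x x′ * (N - deg x - deg x′ + q x x′))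
          ∷ []

        pointwise : ∀ ((x , x′) : Fin n × Fin n) → + 16 * (common P x x′ * common Q x x′) ≡ ⟪ L ⟫ (x , x′)
        pointwise (x , x′) = trans
          (ring 2 (λ a b → # 16 :* (a :* b) := (# 4 :* a) :* (# 4 :* b)) (common P x x′ ∷ common Q x x′ ∷ []))
          (trans (cong₂ _*_ (common-P x x′) (common-Q x x′))
          (ring 6 (λ n d d′ q s e → (n :+ d :+ d′ :+ q :- # 4 :- # 4 :* s :+ # 4 :* e) :* (n :- d :- d′ :+ q)
            := (n :* n :- # 4 :* n) :* # 1 :+ (# 1 :* (q :* q) :+ ((# 2 :* n :- # 4) :* q :+ (con -1ℤ :* (d :* d) :+ (con -1ℤ :* (d′ :* d′)
              :+ (con -[1+ 1 ] :* (d :* d′) :+ (# 4 :* d :+ (# 4 :* d′ :+ ((:- (# 4 :* n)) :* s :+ (# 4 :* (s :* d) :+ (# 4 :* (s :* d′)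
              :+ (con -[1+ 3 ] :* (s :* q) :+ (# 4 :* (e :* (n :- d :- d′ :+ q)) :+ # 0)))))))))))))
            (N ∷ deg x ∷ deg x′ ∷ q x x′ ∷ σ x x′ ∷ δ x x′ ∷ [])))

        sum-δ : sum (λ x → sum λ x′ → δ x x′ * (N - deg x - deg x′ + q x x′)) ≡ + 2 * N * N - + 2 * total
        sum-δ = trans
          (sum-cong λ x → trans (sum-kronecker x _) (trans (cong (λ z → N - deg x - deg x + z) (q-diag x))
            (ring 2 (λ n d → n :- d :- d :+ n := # 2 :* n :* # 1 :+ (con -[1+ 1 ] :* d :+ # 0)) (N ∷ deg x ∷ []))))
          (trans (sum-combination ((+ 2 * N , λ _ → 1ℤ) ∷ (-[1+ 1 ] , deg) ∷ []))
            (trans (+-≡ (cong (+ 2 * N *_) (sum-const n 1ℤ)) refl)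
              (ring 2 (λ n s → # 2 :* n :* (n :* # 1) :+ (con -[1+ 1 ] :* s :+ # 0) := # 2 :* n :* n :- # 2 :* s) (N ∷ total ∷ []))))

        evaluated : apply sum₂ L ≡ N * N * N * N + cycles - + 2 * total * total - + 4 * N * N * N + + 4 * N * total
          + + 4 * squares - + 4 * triangles + + 8 * N * N - + 8 * total
        evaluated = trans
          (+-≡ (cong ((N * N - + 4 * N) *_) (trans (sum-cong λ _ → sum-const n 1ℤ) (sum-const n _)))
          (+-≡ (cong (1ℤ *_) sum-qq)
          (+-≡ (cong ((+ 2 * N - + 4) *_) sum-q)
          (+-≡ (cong (-1ℤ *_) (trans (sum-cong λ x → sum-const n _) (sum-*ˡ N _)))
          (+-≡ (cong (-1ℤ *_) (sum-const n squares))
          (+-≡ (cong (-[1+ 1 ] *_) (trans (sum-cong λ x → sum-*ˡ (deg x) deg) (sum-*ʳ total deg)))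
          (+-≡ (cong (+ 4 *_) (trans (sum-cong λ x → sum-const n (deg x)) (sum-*ˡ N deg)))
          (+-≡ (cong (+ 4 *_) (sum-const n total))
          (+-≡ refl
          (+-≡ (cong (+ 4 *_) (sum-cong λ x → sum-*ʳ (deg x) (σ x)))
          (+-≡ (cong (+ 4 *_) (trans (sum-comm λ x x′ → σ x x′ * deg x′)
            (sum-cong λ x′ → trans (sum-*ʳ (deg x′) _) (cong (_* deg x′) (column x′)))))
          (+-≡ (cong (-[1+ 3 ] *_) sum-σq)
          (+-≡ (cong (+ 4 *_) sum-δ) refl)))))))))))))
          (ring 5 (λ n c z s t →
            (n :* n :- # 4 :* n) :* (n :* (n :* # 1)) :+ (# 1 :* c :+ ((# 2 :* n :- # 4) :* z :+ (con -1ℤ :* (n :* z) :+ (con -1ℤ :* (n :* z)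
              :+ (con -[1+ 1 ] :* (s :* s) :+ (# 4 :* (n :* s) :+ (# 4 :* (n :* s) :+ ((:- (# 4 :* n)) :* s :+ (# 4 :* z :+ (# 4 :* z
              :+ (con -[1+ 3 ] :* t :+ (# 4 :* (# 2 :* n :* n :- # 2 :* s) :+ # 0))))))))))))
            := n :* n :* n :* n :+ c :- # 2 :* s :* s :- # 4 :* n :* n :* n :+ # 4 :* n :* s :+ # 4 :* z :- # 4 :* t :+ # 8 :* n :* n :- # 8 :* s)
            (N ∷ cycles ∷ squares ∷ total ∷ triangles ∷ []))

      diagonal : + 16 * sum (λ x → common P x x * common Q x x) ≡ + 4 * N * N * N - + 4 * squares - + 8 * N * N + + 8 * total
      diagonal = trans (sym (sum-*ˡ (+ 16) _)) (trans (sum-cong pointwise) (trans (sum-combination L)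
        (trans (+-≡ (cong ((+ 4 * N * N - + 8 * N) *_) (sum-const n 1ℤ)) refl)
          (ring 3 (λ n z s → (# 4 :* n :* n :- # 8 :* n) :* (n :* # 1) :+ (con -[1+ 3 ] :* z :+ (# 8 :* s :+ # 0))
            := # 4 :* n :* n :* n :- # 4 :* z :- # 8 :* n :* n :+ # 8 :* s) (N ∷ squares ∷ total ∷ [])))))
        where
        L : Combination (Fin n)
        L = (+ 4 * N * N - + 8 * N , λ _ → 1ℤ) ∷ (-[1+ 3 ] , λ x → deg x * deg x) ∷ (+ 8 , deg) ∷ []
        pointwise : ∀ x → + 16 * (common P x x * common Q x x) ≡ ⟪ L ⟫ x
        pointwise x = trans
          (ring 2 (λ a b → # 16 :* (a :* b) := (# 4 :* a) :* (# 4 :* b)) (common P x x ∷ common Q x x ∷ []))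
          (trans (cong₂ _*_
            (trans (common-P x x) (cong₂ (λ s e → N + deg x + deg x + q x x - + 4 - + 4 * s + + 4 * e) (σ-diag x) (kronecker-refl x)))
            (common-Q x x))
          (trans (cong (λ z → (N + deg x + deg x + z - + 4 - + 4 * 1ℤ + + 4 * 1ℤ) * (N - deg x - deg x + z)) (q-diag x))
            (ring 2 (λ n d → (n :+ d :+ d :+ n :- # 4 :- # 4 :* # 1 :+ # 4 :* # 1) :* (n :- d :- d :+ n)
              := (# 4 :* n :* n :- # 8 :* n) :* # 1 :+ (con -[1+ 3 ] :* (d :* d) :+ (# 8 :* d :+ # 0))) (N ∷ deg x ∷ []))))

    expansion : + 16 * (sum (λ x → sum λ x′ → common P x x′ * common Q x x′) - sum (λ x → common P x x * common Q x x))
      ≡ leading N + excess N (N * N * N * N - cycles) (N * N * N - triangles) squares total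
    expansion = trans (ring 2 (λ a b → # 16 :* (a :- b) := # 16 :* a :- # 16 :* b) (_ ∷ _ ∷ []))
      (trans (cong₂ _-_ pairs diagonal)
        (ring 5 (λ n c z s t →
          (n :* n :* n :* n :+ c :- # 2 :* s :* s :- # 4 :* n :* n :* n :+ # 4 :* n :* s :+ # 4 :* z :- # 4 :* t :+ # 8 :* n :* n :- # 8 :* s)
          :- (# 4 :* n :* n :* n :- # 4 :* z :- # 8 :* n :* n :+ # 8 :* s)
          := # 2 :* n :* n :* n :* n :- # 12 :* n :* n :* n :+ # 16 :* n :* n
            :+ (:- (n :* n :* n :* n :- c) :+ # 4 :* (n :* n :* n :- t) :+ # 8 :* z :- # 2 :* s :* s :+ (# 4 :* n :- # 16) :* s))
          (N ∷ cycles ∷ squares ∷ total ∷ triangles ∷ [])))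

-- Stability

module Stability {m : ℕ} (σ : Fin (suc m) → Fin (suc m) → ℤ) (σ-sign : ∀ i j → IsSign (σ i j)) (σ-sym : ∀ i j → σ i j ≡ σ j i)
  (large : + 100000 ≤ + suc m) (0≤triangles : 0ℤ ≤ SignMatrix.triangles σ σ-sign σ-sym) where

  open SignMatrix σ σ-sign σ-sym

  private
    θ β : ℤ
    θ = N * N * N - triangles
    β = N * N * N * N - cycles

    0≤θ : 0ℤ ≤ θ
    0≤θ = subst (0ℤ ≤_) defect-sum (sum-nonneg Pivot.defect-nonneg)

    -- From `triangles-vs-cycles`, `3 N² β ≥ N⁶ - triangles² = θ (N³ + triangles) ≥ N³ θ`. The last
    -- step is where the choice of the colour with `triangles ≥ 0` enters; then `N²` is cancelled.
    Nθ≤3β : N * θ ≤ + 3 * β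
    Nθ≤3β = *-cancel-≤ m (*-cancel-≤ m (certify-≤ (0≤θ ⊗ 0≤triangles ⊕ ≤⇒0≤- triangles-vs-cycles)
      (ring 3 (λ n t c → (n :* n :* n :- t) :* t :+ (# 2 :* (n :* n :* n :* n :* n :* n) :+ t :* t :- # 3 :* (n :* n :* c))
        := n :* (n :* (# 3 :* (n :* n :* n :* n :- c))) :- n :* (n :* (n :* (n :* n :* n :- t))))
        (N ∷ triangles ∷ cycles ∷ []))))

  pivot : Fin (suc m)
  pivot = proj₁ (below-average Pivot.defect)

  open Pivot pivot

  private
    G : ℤ
    G = excess N β θ squares total

    u : ℤ
    u = deg pivot * deg pivot

    open Estimate N large β θ squares total u defect Nθ≤3β (subst (N * defect ≤_) defect-sum (proj₂ (below-average Pivot.defect)))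
      defect-nonneg squares≤ total≤ total≥

    -- A sum of nonnegative entries that is at most 0 has all its entries 0, and `split` then reads
    -- `σ = ω`.
    defect-zero : defect ≤ 0ℤ → ∀ i j → σ i j ≡ σ pivot i * σ pivot j
    defect-zero defect≤0 i j = trans (split i j) (trans (cong (λ z → ω i j * (1ℤ - z)) η≡0)
      (ring 1 (λ a → a :* (# 1 :- # 0) := a) (ω i j ∷ [])))
      where
      η≡0 : η i j ≡ 0ℤ
      η≡0 = ℤₚ.≤-antisym (ℤₚ.≤-trans (ℤₚ.≤-trans (term≤sum (η-nonneg i) j)
        (term≤sum (λ i → sum-nonneg (η-nonneg i)) i)) defect≤0) (η-nonneg i j)

  dichotomy : (G < 0ℤ ⊎ G < profile N u) ⊎ (∀ i j → σ i j ≡ σ pivot i * σ pivot j)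
  dichotomy with defect ℤₚ.≤? 0ℤ
  ... | yes defect≤0 = inj₂ (defect-zero defect≤0)
  -- Integrality upgrades a positive defect to a defect of at least 1, as the strict estimate
  -- requires.
  ... | no defect≰0 = inj₁ (excess<profile squares≤N³ (ℤₚ.i<j⇒suc[i]≤j (ℤₚ.≰⇒> defect≰0)))

-- Counting RRBB-cycles

-- The conversion from Bool to ℕ used by rrbbCount is private to Defs; unification recovers it.
summand : ∀ {n r} {f : Fin n → ℕ} → r ≡ ListAction.sum (List.map f (allFin n)) → Fin n → ℕ
summand {f = f} _ = f

indicator : Bool → ℕ
indicator b = (λ n (S : Fin n → Bool) → summand {n} {sideSize S} refl) 1 (λ _ → b) zero

list-sum : ∀ {n} (f : Fin n → ℕ) → + ListAction.sum (List.map f (allFin n)) ≡ sum (λ i → + f i)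
list-sum f = trans (cong (λ l → + ListAction.sum l) (Listₚ.map-tabulate (λ i → i) f)) (tabulated f)
  where
  tabulated : ∀ {n} (f : Fin n → ℕ) → + ListAction.sum (tabulate f) ≡ sum (λ i → + f i)
  tabulated {zero} f = sym (sum-zero _)
  tabulated {suc n} f = trans (pos-+ (f zero) _) (trans (+-≡ refl (tabulated λ i → f (suc i))) (sym (sum-suc _)))

edgeValue : Bool → Bool → ℤ
edgeValue true  true  = 1ℤ
edgeValue true  false = 0ℤ
edgeValue false true  = 0ℤ
edgeValue false false = 1ℤ

edge : ∀ {n} → Colouring n → Bool → Fin n → Fin n → ℤ
edge c d i j = if does (i Fin.≟ j) then 0ℤ else edgeValue d (c i j)

edge-diag : ∀ {n} (c : Colouring n) d i → edge c d i i ≡ 0ℤ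
edge-diag c d i rewrite dec-true (i Fin.≟ i) refl = refl

edge-off : ∀ {n} (c : Colouring n) d {i j} → i ≢ j → edge c d i j ≡ edgeValue d (c i j)
edge-off c d {i} {j} i≢j rewrite dec-false (i Fin.≟ j) i≢j = refl

before : ∀ {n} → Fin n → Fin n → ℤ
before i j with i Fin.<? j
... | yes _ = 1ℤ
... | no _ = 0ℤ

before-kronecker : ∀ {n} (i j : Fin n) → before i j + before j i ≡ 1ℤ - kronecker i j
before-kronecker i j with Finₚ.<-cmp i j | i Fin.<? j | j Fin.<? i
... | tri< i<j i≢j j≮i | yes _ | no _ rewrite kronecker-off i≢j = ring 0 (# 1 :+ # 0 := # 1 :- # 0) []
... | tri> i≮j i≢j j<i | no _ | yes _ rewrite kronecker-off i≢j = ring 0 (# 0 :+ # 1 := # 1 :- # 0) []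
... | tri≈ i≮i refl _ | no _ | no _ rewrite kronecker-refl i = ring 0 (# 0 :+ # 0 := # 1 :- # 1) []
... | tri< i<j _ j≮i | no i≮j | _ = contradiction i<j i≮j
... | tri< i<j _ j≮i | _ | yes j<i = contradiction j<i j≮i
... | tri> i≮j _ j<i | _ | no j≮i = contradiction j<i j≮i
... | tri> i≮j _ j<i | yes i<j | _ = contradiction i<j i≮j
... | tri≈ i≮i refl _ | yes i<i | _ = contradiction i<i i≮i
... | tri≈ i≮i refl _ | _ | yes i<i = contradiction i<i i≮i

module Count {n} (c : Colouring n) (c-sym : Symmetric c) where

  P Q : Fin n → Fin n → ℤ
  P = edge c true
  Q = edge c false

  -- The product already encodes that the vertices are distinct. `before` separates `x` and `x′`,
  -- the zero diagonals of `P` and `Q` separate `y` and `z` from both of them, and `y` differs from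
  -- `z` because the edges from `x` to them have different colours (`clash`).
  isRRBB-edges : ∀ x y x′ z → + indicator (isRRBB c x y x′ z) ≡ before x x′ * (P x y * P x′ y * (Q x z * Q x′ z))
  isRRBB-edges x y x′ z with x Fin.<? x′
  ... | no _ = sym (ring 1 (λ a → # 0 :* a := # 0) (P x y * P x′ y * (Q x z * Q x′ z) ∷ []))
  ... | yes _ with x Fin.≟ y
  ...   | yes _ = sym (ring 2 (λ a b → # 1 :* (# 0 :* a :* b) := # 0) (P x′ y ∷ Q x z * Q x′ z ∷ []))
  ...   | no _ with x Fin.≟ z
  ...     | yes _ = sym (ring 2 (λ a b → # 1 :* (a :* (# 0 :* b)) := # 0) (edgeValue true (c x y) * P x′ y ∷ Q x′ z ∷ []))
  ...     | no _ with y Fin.≟ x′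
  ...       | yes refl rewrite edge-diag c true y = sym (ring 2 (λ a b → # 1 :* (a :* # 0 :* b) := # 0) (edgeValue true (c x y) ∷ edgeValue false (c x z) * Q y z ∷ []))
  ...       | no y≢x′ rewrite edge-off c true (≢-sym y≢x′) with y Fin.≟ z
  ...         | yes refl = sym (clash (c x y))
    where
    clash : ∀ b → 1ℤ * (edgeValue true b * edgeValue true (c x′ y) * (edgeValue false b * Q x′ y)) ≡ 0ℤ
    clash true = ring 2 (λ a b → # 1 :* (# 1 :* a :* (# 0 :* b)) := # 0) (edgeValue true (c x′ y) ∷ Q x′ y ∷ [])
    clash false = ring 2 (λ a b → # 1 :* (# 0 :* a :* (# 1 :* b)) := # 0) (edgeValue true (c x′ y) ∷ Q x′ y ∷ [])
  ...         | no _ with x′ Fin.≟ z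
  ...           | yes _ = sym (ring 2 (λ a b → # 1 :* (a :* (b :* # 0)) := # 0) (edgeValue true (c x y) * edgeValue true (c x′ y) ∷ edgeValue false (c x z) ∷ []))
  ...           | no _ rewrite c-sym y x′ | c-sym z x with c x y | c x′ y | c x′ z | c x z
  ...             | true | true | false | false = ring 0 (# 1 := # 1 :* (# 1 :* # 1 :* (# 1 :* # 1))) []
  ...             | true | true | false | true = ring 0 (# 0 := # 1 :* (# 1 :* # 1 :* (# 0 :* # 1))) []
  ...             | true | true | true | q = ring 1 (λ q → # 0 := # 1 :* (# 1 :* # 1 :* (q :* # 0))) (edgeValue false q ∷ [])
  ...             | true | false | p | q = ring 2 (λ p q → # 0 := # 1 :* (# 1 :* # 0 :* (q :* p))) (edgeValue false p ∷ edgeValue false q ∷ [])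
  ...             | false | r | p | q = ring 3 (λ p q r → # 0 := # 1 :* (# 0 :* r :* (q :* p))) (edgeValue false p ∷ edgeValue false q ∷ edgeValue true r ∷ [])

  -- The vertices `x` and `x′` are the two at which the colour changes. Given them, the vertex
  -- between the red edges and the one between the blue edges are chosen independently, hence the
  -- product. The product is symmetric in `x` and `x′`, so doubling the sum over `x < x′` gives all
  -- ordered pairs off the diagonal.
  rrbbCount-common : + 2 * + rrbbCount c ≡
    sum (λ x → sum λ x′ → common P x x′ * common Q x x′) - sum (λ x → common P x x * common Q x x)
  rrbbCount-common = trans (cong (+ 2 *_) ordered) twice
    where
    f : Fin n → Fin n → ℤ
    f x x′ = common P x x′ * common Q x x′

    f-comm : ∀ x x′ → f x x′ ≡ f x′ x
    f-comm x x′ = cong₂ _*_ (common-comm P x x′) (common-comm Q x x′)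

    ordered : + rrbbCount c ≡ sum λ x → sum λ x′ → before x x′ * f x x′
    ordered = trans
      (trans (list-sum _) (sum-cong λ x → trans (list-sum _) (sum-cong λ y → trans (list-sum _) (sum-cong λ x′ →
        trans (list-sum _) (sum-cong λ z → isRRBB-edges x y x′ z)))))
      (sum-cong λ x → trans
        (sum-comm λ y x′ → sum λ z → before x x′ * (P x y * P x′ y * (Q x z * Q x′ z)))
        (sum-cong λ x′ → trans
          (sum-cong λ y → trans (sum-*ˡ (before x x′) _) (cong (before x x′ *_) (sum-*ˡ (P x y * P x′ y) _)))
          (trans (sum-*ˡ (before x x′) _) (cong (before x x′ *_) (sum-*ʳ (common Q x x′) _)))))

    twice : + 2 * sum (λ x → sum λ x′ → before x x′ * f x x′) ≡ sum (λ x → sum λ x′ → f x x′) - sum (λ x → f x x)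
    twice = trans (ring 1 (λ a → # 2 :* a := a :+ a) (_ ∷ []))
      (trans (+-≡ refl (trans (sum-comm _) (sum-cong λ x′ → sum-cong λ x → cong (before x x′ *_) (f-comm x x′))))
      (trans (sym (trans (sum-cong λ x → sum-+ _ _) (sum-+ _ _)))
      (trans (sum-cong λ x → trans
        (sum-cong λ x′ → trans (ring 3 (λ a b c → a :* c :+ b :* c := (a :+ b) :* c) (before x x′ ∷ before x′ x ∷ f x x′ ∷ []))
          (trans (cong (_* f x x′) (before-kronecker x x′)) (ring 2 (λ k c → (# 1 :- k) :* c := c :- k :* c) (kronecker x x′ ∷ f x x′ ∷ []))))
        (trans (sum-minus (f x) _) (cong (λ z → sum (f x) - z) (sum-kronecker x (f x)))))
      (sum-minus (λ x → sum (f x)) λ x → f x x))))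

-- The sign matrix of a colour

boolSign : Bool → Bool → ℤ
boolSign true  true  = 1ℤ
boolSign true  false = -1ℤ
boolSign false true  = -1ℤ
boolSign false false = 1ℤ

boolSign-sign : ∀ d b → IsSign (boolSign d b)
boolSign-sign true  true  = plus
boolSign-sign true  false = minus
boolSign-sign false true  = minus
boolSign-sign false false = plus

module Agreement {n} (c : Colouring n) (c-sym : Symmetric c) where

  agree : Bool → Fin n → Fin n → ℤ
  agree d i j with i Fin.≟ j
  ... | yes _ = 1ℤ
  ... | no _ = boolSign d (c i j)

  agree-sign : ∀ d i j → IsSign (agree d i j)
  agree-sign d i j with i Fin.≟ j
  ... | yes _ = plus
  ... | no _ = boolSign-sign d (c i j)

  agree-diag : ∀ d i → agree d i i ≡ 1ℤ
  agree-diag d i with i Fin.≟ i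
  ... | yes _ = refl
  ... | no i≢i = contradiction refl i≢i

  agree-off : ∀ d {i j} → i ≢ j → agree d i j ≡ boolSign d (c i j)
  agree-off d {i} {j} i≢j with i Fin.≟ j
  ... | yes i≡j = contradiction i≡j i≢j
  ... | no _ = refl

  agree-sym : ∀ d i j → agree d i j ≡ agree d j i
  agree-sym d i j with i Fin.≟ j
  ... | yes refl = sym (agree-diag d i)
  ... | no i≢j = trans (cong (boolSign d) (c-sym i j)) (sym (agree-off d (≢-sym i≢j)))

  agree-neg : ∀ {i j} → i ≢ j → agree false i j ≡ - agree true i j
  agree-neg {i} {j} i≢j rewrite agree-off true i≢j | agree-off false i≢j with c i j
  ... | true = ring 0 (con -1ℤ := :- # 1) []
  ... | false = ring 0 (# 1 := :- con -1ℤ) []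

  2*edge-same : ∀ d i j → + 2 * edge c d i j ≡ 1ℤ + agree d i j - + 2 * kronecker i j
  2*edge-same d i j with i Fin.≟ j
  ... | yes refl = ring 0 (# 2 :* # 0 := # 1 :+ # 1 :- # 2 :* # 1) []
  ... | no _ with d | c i j
  ...   | true | true = ring 0 (# 2 :* # 1 := # 1 :+ # 1 :- # 2 :* # 0) []
  ...   | true | false = ring 0 (# 2 :* # 0 := # 1 :+ con -1ℤ :- # 2 :* # 0) []
  ...   | false | true = ring 0 (# 2 :* # 0 := # 1 :+ con -1ℤ :- # 2 :* # 0) []
  ...   | false | false = ring 0 (# 2 :* # 1 := # 1 :+ # 1 :- # 2 :* # 0) []

  2*edge-other : ∀ d i j → + 2 * edge c (not d) i j ≡ 1ℤ - agree d i j
  2*edge-other d i j with i Fin.≟ j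
  ... | yes refl = ring 0 (# 2 :* # 0 := # 1 :- # 1) []
  ... | no _ with d | c i j
  ...   | true | true = ring 0 (# 2 :* # 0 := # 1 :- # 1) []
  ...   | true | false = ring 0 (# 2 :* # 1 := # 1 :- con -1ℤ) []
  ...   | false | true = ring 0 (# 2 :* # 1 := # 1 :- con -1ℤ) []
  ...   | false | false = ring 0 (# 2 :* # 0 := # 1 :- # 1) []

  module Matrix (d : Bool) = SignMatrix (agree d) (agree-sign d) (agree-sym d)

  N = + n

  excessOf : Bool → ℤ
  excessOf d = excess N (N * N * N * N - cycles) (N * N * N - triangles) squares total
    where open Matrix d using (cycles; triangles; squares; total)

  -- The count does not change when the colours are exchanged, so the formula is available for
  -- whichever colour has nonnegative trace of σ³. The factor 32 is 16, for the four halves in the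
  -- edge indicators, times 2 for ordered pairs.
  rrbbCount-excess : ∀ d → + 32 * + rrbbCount c ≡ leading N + excessOf d
  rrbbCount-excess d = trans (ring 1 (λ a → # 32 :* a := # 16 :* (# 2 :* a)) (+ rrbbCount c ∷ []))
    (trans (cong (+ 16 *_) (trans rrbbCount-common (swap d)))
      (Expansion.expansion (agree d) (agree-sign d) (agree-sym d) (agree-diag d)
        (edge c d) (edge c (not d)) (2*edge-same d) (2*edge-other d)))
    where
    open Count c c-sym using (rrbbCount-common)
    swap : ∀ d → sum (λ x → sum λ x′ → common (edge c true) x x′ * common (edge c false) x x′)
        - sum (λ x → common (edge c true) x x * common (edge c false) x x)
      ≡ sum (λ x → sum λ x′ → common (edge c d) x x′ * common (edge c (not d)) x x′)
        - sum (λ x → common (edge c d) x x * common (edge c (not d)) x x)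
    swap true = refl
    swap false = cong₂ _-_
      (sum-cong λ x → sum-cong λ x′ → *-comm (common (edge c true) x x′) (common (edge c false) x x′))
      (sum-cong λ x → *-comm (common (edge c true) x x) (common (edge c false) x x))
      where open CommutativeRing ℤ-ring using (*-comm)

  -- A triangle is positive for one of the two colours, and a degenerate one for both.
  triangles-sum-nonneg : 0ℤ ≤ Matrix.triangles true + Matrix.triangles false
  triangles-sum-nonneg = subst (0ℤ ≤_)
    (trans (sum-cong λ i → trans (sum-cong λ j → sum-+ _ _) (sum-+ _ _)) (sum-+ _ _))
    (sum-nonneg λ i → sum-nonneg λ j → sum-nonneg λ k → pointwise i j k)
    where
    τ : Bool → Fin n → Fin n → Fin n → ℤ
    τ d i j k = agree d i j * agree d j k * agree d k i

    back : ∀ d i j → agree d i j * agree d j i ≡ 1ℤ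
    back d i j = trans (cong (agree d i j *_) (agree-sym d j i)) (sign-square (agree-sign d i j))

    degenerate : ∀ {a b} → a ≡ 1ℤ → b ≡ 1ℤ → 0ℤ ≤ a + b
    degenerate refl refl = lit 1 ⊕ lit 1

    pointwise : ∀ i j k → 0ℤ ≤ τ true i j k + τ false i j k
    pointwise i j k = distinct? (i Fin.≟ j) (j Fin.≟ k) (k Fin.≟ i)
      where
      distinct? : _ → _ → _ → 0ℤ ≤ τ true i j k + τ false i j k
      distinct? (yes refl) _ _ = degenerate (eq true) (eq false)
        where
        eq : ∀ d → τ d i i k ≡ 1ℤ
        eq d = trans (cong (λ z → z * agree d i k * agree d k i) (agree-diag d i))
          (trans (ring 2 (λ a b → # 1 :* a :* b := a :* b) (agree d i k ∷ agree d k i ∷ [])) (back d i k))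
      distinct? (no _) (yes refl) _ = degenerate (eq true) (eq false)
        where
        eq : ∀ d → τ d i j j ≡ 1ℤ
        eq d = trans (cong (λ z → agree d i j * z * agree d j i) (agree-diag d j))
          (trans (ring 2 (λ a b → a :* # 1 :* b := a :* b) (agree d i j ∷ agree d j i ∷ [])) (back d i j))
      distinct? (no _) (no _) (yes refl) = degenerate (eq true) (eq false)
        where
        eq : ∀ d → τ d i j i ≡ 1ℤ
        eq d = trans (cong (λ z → agree d i j * agree d j i * z) (agree-diag d i))
          (trans (ring 2 (λ a b → a :* b :* # 1 := a :* b) (agree d i j ∷ agree d j i ∷ [])) (back d i j))
      distinct? (no i≢j) (no j≢k) (no k≢i) = ℤₚ.≤-reflexive (sym (trans
        (cong (λ z → τ true i j k + z) (cong₂ _*_ (cong₂ _*_ (agree-neg i≢j) (agree-neg j≢k)) (agree-neg k≢i)))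
        (ring 3 (λ a b c → a :* b :* c :+ :- a :* :- b :* :- c := # 0) (agree true i j ∷ agree true j k ∷ agree true k i ∷ []))))

  majority : ∃ λ d → 0ℤ ≤ Matrix.triangles d
  majority with ℤₚ.≤-total 0ℤ (Matrix.triangles true)
  ... | inj₁ 0≤ = true , 0≤
  ... | inj₂ ≤0 = false , ℤₚ.≤-trans triangles-sum-nonneg
    (certify-≤ (≤⇒0≤- ≤0) (ring 2 (λ a b → # 0 :- a := b :- (a :+ b)) (Matrix.triangles true ∷ Matrix.triangles false ∷ [])))

-- The optimal part size

-- The search behind floorSqrt is private to Defs; unification recovers it,
-- after abstracting suc k so that its two arguments are distinct variables.
mutual
  search-below : ℕ → ℕ
  search-below = _

  floorSqrt-suc : ∀ k → floorSqrt (suc k) ≡ (if suc k ℕ.* suc k ≤ᵇ suc k then suc k else search-below k)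
  floorSqrt-suc k = refl

mutual
  search : ℕ → ℕ → ℕ
  search = _

  search-spec : ∀ k → Σ ℕ λ r → r ≡ search-below k
  search-spec k with suc k
  ... | m = search m k , refl

search-square≤ : ∀ m k → search m k ℕ.* search m k ℕ.≤ m
search-square≤ m zero = z≤n
search-square≤ m (suc k) with suc k ℕ.* suc k ≤ᵇ m in eq
... | true = ℕₚ.≤ᵇ⇒≤ _ m (subst T (sym eq) _)
... | false = search-square≤ m k

search-maximal : ∀ m k j → j ℕ.≤ k → j ℕ.* j ℕ.≤ m → j ℕ.≤ search m k
search-maximal m zero j j≤k _ = j≤k
search-maximal m (suc k) j j≤k jj≤m with suc k ℕ.* suc k ≤ᵇ m in eq
... | true = j≤k
... | false with ℕₚ.m≤n⇒m<n∨m≡n j≤k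
...   | inj₁ (s≤s j≤k′) = search-maximal m k j j≤k′ jj≤m
...   | inj₂ refl = contradiction (subst T eq (ℕₚ.≤⇒≤ᵇ jj≤m)) λ ()

floorSqrt-square≤ : ∀ m → floorSqrt m ℕ.* floorSqrt m ℕ.≤ m
floorSqrt-square≤ m = search-square≤ m m

floorSqrt-maximal : ∀ m j → j ℕ.* j ℕ.≤ m → j ℕ.≤ floorSqrt m
floorSqrt-maximal m zero jj≤m = z≤n
floorSqrt-maximal m (suc j) jj≤m = search-maximal m m (suc j) (ℕₚ.≤-trans (ℕₚ.m≤m*n (suc j) (suc j)) jj≤m) jj≤m

ceilSqrt-square≥ : ∀ m → m ℕ.≤ ceilSqrt m ℕ.* ceilSqrt m
ceilSqrt-square≥ m with floorSqrt m ℕ.* floorSqrt m ≡ᵇ m in eq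
... | true = ℕₚ.≤-reflexive (sym (ℕₚ.≡ᵇ⇒≡ _ m (subst T (sym eq) _)))
... | false with ℕₚ.≤-total m (suc (floorSqrt m) ℕ.* suc (floorSqrt m))
...   | inj₁ m≤ = m≤
...   | inj₂ ≤m = contradiction (floorSqrt-maximal m _ ≤m) (ℕₚ.<⇒≱ ℕₚ.≤-refl)

ceilSqrt≤ : ∀ m → ceilSqrt m ℕ.≤ suc (floorSqrt m)
ceilSqrt≤ m with floorSqrt m ℕ.* floorSqrt m ≡ᵇ m
... | true = ℕₚ.n≤1+n _
... | false = ℕₚ.≤-refl

2*C2 : ∀ n → + 2 * + (n C 2) ≡ + n * (+ n - 1ℤ)
2*C2 zero = ring 0 (# 2 :* # 0 := # 0 :* (# 0 :- # 1)) []
2*C2 (suc n) = trans (cong (λ k → + 2 * + k) (trans (sym (nCk+nC[k+1]≡[n+1]C[k+1] n 1)) (cong (ℕ._+ n C 2) (nC1≡n n))))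
  (trans (cong (+ 2 *_) (pos-+ n (n C 2)))
  (trans (ring 2 (λ n c → # 2 :* (n :+ c) := # 2 :* n :+ # 2 :* c) (+ n ∷ + (n C 2) ∷ []))
  (trans (cong (λ z → + 2 * + n + z) (2*C2 n))
  (trans (ring 1 (λ n → # 2 :* n :+ n :* (n :- # 1) := (# 1 :+ n) :* (# 1 :+ n :- # 1)) (+ n ∷ []))
    (cong (λ z → z * (z - 1ℤ)) (sym (pos-suc n)))))))

6*C3 : ∀ n → + 6 * + (n C 3) ≡ + n * (+ n - 1ℤ) * (+ n - + 2)
6*C3 zero = ring 0 (# 6 :* # 0 := # 0 :* (# 0 :- # 1) :* (# 0 :- # 2)) []
6*C3 (suc n) = trans (cong (λ k → + 6 * + k) (sym (nCk+nC[k+1]≡[n+1]C[k+1] n 2)))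
  (trans (cong (+ 6 *_) (pos-+ (n C 2) (n C 3)))
  (trans (ring 2 (λ b c → # 6 :* (b :+ c) := # 3 :* (# 2 :* b) :+ # 6 :* c) (+ (n C 2) ∷ + (n C 3) ∷ []))
  (trans (cong₂ (λ b c → + 3 * b + c) (2*C2 n) (6*C3 n))
  (trans (ring 1 (λ n → # 3 :* (n :* (n :- # 1)) :+ n :* (n :- # 1) :* (n :- # 2) := (# 1 :+ n) :* (# 1 :+ n :- # 1) :* (# 1 :+ n :- # 2)) (+ n ∷ []))
    (cong (λ z → z * (z - 1ℤ) * (z - + 2)) (sym (pos-suc n)))))))

imbalance : ℕ → ℕ → ℤ
imbalance n a = + 2 * + a - + n

-- An identity of polynomials in `a` and `n - a`. The argument `imbalance` is the entry sum of the
-- sign vector of a side of size `a`, so this has the same shape as the counting formula for a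
-- bipartite colouring.
bound-profile : ∀ n a → a ℕ.≤ n → + 32 * + bound n a ≡ leading (+ n) + profile (+ n) (imbalance n a * imbalance n a)
bound-profile n a a≤n = trans
  (cong (+ 32 *_) (trans (pos-* 3 _) (cong (+ 3 *_) (trans (pos-+ (a ℕ.* (b C 3)) _) (+-≡ (pos-* a _) (pos-* b _))))))
  (trans (ring 4 (λ a b p q → # 32 :* (# 3 :* (a :* p :+ b :* q)) := # 16 :* (a :* (# 6 :* p) :+ b :* (# 6 :* q)))
    (+ a ∷ + b ∷ + (b C 3) ∷ + (a C 3) ∷ []))
  (trans (cong₂ (λ p q → + 16 * (+ a * p + + b * q)) (6*C3 b) (6*C3 a))
  (trans (ring 2 (λ a b → # 16 :* (a :* (b :* (b :- # 1) :* (b :- # 2)) :+ b :* (a :* (a :- # 1) :* (a :- # 2)))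
      := (# 2 :* (a :+ b) :* (a :+ b) :* (a :+ b) :* (a :+ b) :- # 12 :* (a :+ b) :* (a :+ b) :* (a :+ b) :+ # 16 :* (a :+ b) :* (a :+ b))
        :+ (:- (# 2 :* ((# 2 :* a :- (a :+ b)) :* (# 2 :* a :- (a :+ b))) :* ((# 2 :* a :- (a :+ b)) :* (# 2 :* a :- (a :+ b))))
          :+ (# 12 :* (a :+ b) :- # 16) :* ((# 2 :* a :- (a :+ b)) :* (# 2 :* a :- (a :+ b))))) (+ a ∷ + b ∷ []))
    (cong (λ N → leading N + profile N ((+ 2 * + a - N) * (+ 2 * + a - N))) n≡))))
  where
  b = n ∸ a
  n≡ : + a + + b ≡ + n
  n≡ = trans (sym (pos-+ a b)) (cong +_ (ℕₚ.m+[n∸m]≡n a≤n))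

module Optimum (n : ℕ) (large : + 100000 ≤ + n) where

  private
    N M : ℤ
    N = + n
    M = + 3 * N - + 4

    m q r : ℕ
    m = 3 ℕ.* n ∸ 4
    q = floorSqrt m
    r = ceilSqrt m

    n-large : 100000 ℕ.≤ n
    n-large = ℤₚ.drop‿+≤+ large

    m≡M : + m ≡ M
    m≡M = trans (ring 1 (λ m → m := m :+ # 4 :- # 4) (+ m ∷ []))
      (cong (λ z → z - + 4) (trans (sym (pos-+ m 4)) (trans (cong +_ (ℕₚ.m∸n+n≡m 4≤3n)) (pos-* 3 n))))
      where
      4≤3n : 4 ℕ.≤ 3 ℕ.* n
      4≤3n = ℕₚ.≤-trans (ℕₚ.≤ᵇ⇒≤ 4 100000 _) (ℕₚ.≤-trans n-large (ℕₚ.m≤n*m n 3))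

    q²≤M : + q * + q ≤ M
    q²≤M = subst₂ _≤_ (pos-* q q) m≡M (+≤+ (floorSqrt-square≤ m))

    M≤r² : M ≤ + r * + r
    M≤r² = subst₂ _≤_ m≡M (pos-* r r) (+≤+ (ceilSqrt-square≥ m))

    r≤1+q : + r ≤ 1ℤ + + q
    r≤1+q = subst (+ r ≤_) (pos-suc q) (+≤+ (ceilSqrt≤ m))

    1≤q : 1ℤ ≤ + q
    1≤q = +≤+ (floorSqrt-maximal m 1 (ℤₚ.drop‿+≤+ (subst (1ℤ ≤_) (sym m≡M)
      (certify-≤ (lit 3 ⊗ gap large 2 ⊕ lit 1) (ring 1 (λ n → # 3 :* (n :- # 2) :+ # 1 := # 3 :* n :- # 4 :- # 1) (N ∷ []))))))

    half-bounds : ∀ k → + 2 * + (k DivMod./ 2) ≤ + k × + k ≤ + 2 * + (k DivMod./ 2) + 1ℤ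
    half-bounds k = certify-≤ (lit (k DivMod.% 2)) (trans (ring 2 (λ a b → b := (b :+ a :* # 2) :- # 2 :* a) (+ h ∷ + (k DivMod.% 2) ∷ []))
        (cong (λ z → z - + 2 * + h) (sym k≡)))
      , certify-≤ (≤⇒0≤- {+ (k DivMod.% 2)} {1ℤ} (+≤+ (ℕₚ.≤-pred (DivMod.m%n<n k 2))))
        (trans (ring 2 (λ a b → # 1 :- b := # 2 :* a :+ # 1 :- (b :+ a :* # 2)) (+ h ∷ + (k DivMod.% 2) ∷ []))
        (cong (λ z → + 2 * + h + 1ℤ - z) (sym k≡)))
      where
      h = k DivMod./ 2
      k≡ : + k ≡ + (k DivMod.% 2) + + h * + 2
      k≡ = trans (cong +_ (DivMod.m≡m%n+[m/n]*n k 2)) (trans (pos-+ (k DivMod.% 2) _) (cong (λ z → + (k DivMod.% 2) + z) (pos-* h 2)))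

    low-bounds : + 2 * + lowA n ≤ N + + q × N + + q ≤ + 2 * + lowA n + 1ℤ
    low-bounds = subst (λ z → + 2 * + lowA n ≤ z × z ≤ + 2 * + lowA n + 1ℤ) (pos-+ n q) (half-bounds (n ℕ.+ q))

    high-bounds : + 2 * + highA n ≤ N + + r + 1ℤ × N + + r + 1ℤ ≤ + 2 * + highA n + 1ℤ
    high-bounds = subst (λ z → + 2 * + highA n ≤ z × z ≤ + 2 * + highA n + 1ℤ)
      (trans (pos-+ (n ℕ.+ r) 1) (cong (λ z → z + 1ℤ) (pos-+ n r))) (half-bounds (n ℕ.+ r ℕ.+ 1))

  value : ℕ → ℤ
  value a = profile N (imbalance n a * imbalance n a)

  private
    t : ℕ → ℤ
    t = imbalance n

    0≤t-low : 0ℤ ≤ t (lowA n)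
    0≤t-low = certify-≤ (≤⇒0≤- (proj₂ low-bounds) ⊕ ≤⇒0≤- 1≤q)
      (ring 3 (λ l n q → (# 2 :* l :+ # 1 :- (n :+ q)) :+ (q :- # 1) := # 2 :* l :- n :- # 0) (+ lowA n ∷ N ∷ + q ∷ []))

    t-low≤q : t (lowA n) ≤ + q
    t-low≤q = certify-≤ (≤⇒0≤- (proj₁ low-bounds)) (ring 3 (λ l n q → n :+ q :- # 2 :* l := q :- (# 2 :* l :- n)) (+ lowA n ∷ N ∷ + q ∷ []))

    r≤t-high : + r ≤ t (highA n)
    r≤t-high = certify-≤ (≤⇒0≤- (proj₂ high-bounds)) (ring 3 (λ h n r → # 2 :* h :+ # 1 :- (n :+ r :+ # 1) := # 2 :* h :- n :- r) (+ highA n ∷ N ∷ + r ∷ []))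

    square-mono : ∀ {a b} → 0ℤ ≤ a → a ≤ b → a * a ≤ b * b
    square-mono {a} {b} 0≤a a≤b = certify-≤ (≤⇒0≤- a≤b ⊗ (≤⇒0≤- a≤b ⊕ 0≤a ⊕ 0≤a))
      (ring 2 (λ a b → (b :- a) :* (b :- a :+ a :+ a) := b :* b :- a :* a) (a ∷ b ∷ []))

    low²≤M : t (lowA n) * t (lowA n) ≤ M
    low²≤M = ℤₚ.≤-trans (square-mono 0≤t-low t-low≤q) q²≤M

    M≤high² : M ≤ t (highA n) * t (highA n)
    M≤high² = ℤₚ.≤-trans M≤r² (square-mono (lit r) r≤t-high)

    -- profile N u = 2 M² - 2 (u - M)², so the profile increases up to M and decreases after it
    profile-increasing : ∀ {u v} → 0ℤ ≤ v - u - 1ℤ → v ≤ M → profile N u < profile N v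
    profile-increasing {u} {v} u<v v≤M = certify-< 1
      (lit 2 ⊗ (u<v ⊗ (u<v ⊕ lit 2) ⊕ lit 2 ⊗ ≤⇒0≤- v≤M ⊗ (u<v ⊕ lit 1)))
      (ring 3 (λ n u v → # 2 :* ((v :- u :- # 1) :* (v :- u :- # 1 :+ # 2) :+ # 2 :* (# 3 :* n :- # 4 :- v) :* (v :- u :- # 1 :+ # 1)) :+ # 2
        := :- (# 2 :* v :* v) :+ (# 12 :* n :- # 16) :* v :- (:- (# 2 :* u :* u) :+ (# 12 :* n :- # 16) :* u)) (N ∷ u ∷ v ∷ []))

    profile-decreasing : ∀ {u v} → 0ℤ ≤ v - u - 1ℤ → M ≤ u → profile N v < profile N u
    profile-decreasing {u} {v} u<v M≤u = certify-< 1
      (lit 2 ⊗ (u<v ⊗ (u<v ⊕ lit 2) ⊕ lit 2 ⊗ ≤⇒0≤- M≤u ⊗ (u<v ⊕ lit 1)))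
      (ring 3 (λ n u v → # 2 :* ((v :- u :- # 1) :* (v :- u :- # 1 :+ # 2) :+ # 2 :* (u :- (# 3 :* n :- # 4)) :* (v :- u :- # 1 :+ # 1)) :+ # 2
        := :- (# 2 :* u :* u) :+ (# 12 :* n :- # 16) :* u :- (:- (# 2 :* v :* v) :+ (# 12 :* n :- # 16) :* v)) (N ∷ u ∷ v ∷ []))

    square-gap : ∀ {a b} → 0ℤ ≤ t a → a ℕ.< b → 0ℤ ≤ t b * t b - t a * t a - 1ℤ
    square-gap {a} {b} 0≤ta a<b = subst (0ℤ ≤_)
      (ring 3 (λ a b n → (# 2 :* (b :- a :- # 1) :+ # 1) :* (# 2 :* (b :- a :- # 1) :+ # 2 :+ (# 2 :* a :- n) :+ (# 2 :* a :- n))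
          :+ (# 2 :* (b :- a :- # 1) :+ # 1) :+ (# 2 :* a :- n) :+ (# 2 :* a :- n)
        := (# 2 :* b :- n) :* (# 2 :* b :- n) :- (# 2 :* a :- n) :* (# 2 :* a :- n) :- # 1) (+ a ∷ + b ∷ N ∷ []))
      ((lit 2 ⊗ diff ⊕ lit 1) ⊗ (lit 2 ⊗ diff ⊕ lit 2 ⊕ 0≤ta ⊕ 0≤ta) ⊕ (lit 2 ⊗ diff ⊕ lit 1) ⊕ 0≤ta ⊕ 0≤ta)
      where
      diff : 0ℤ ≤ + b - + a - 1ℤ
      diff = <⇒0≤ (+<+ a<b)

    q<n : q ℕ.< n
    q<n = ℕₚ.≰⇒> λ n≤q → ℤₚ.<⇒≱ (certify-< 3 (lit n ⊗ gap large 3)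
      (ring 1 (λ n → n :* (n :- # 3) :+ # 4 := n :* n :- (# 3 :* n :- # 4)) (N ∷ [])))
      (ℤₚ.≤-trans (square-mono (lit n) (+≤+ n≤q)) q²≤M)

  low≤n : lowA n ℕ.≤ n
  low≤n = ℤₚ.drop‿+≤+ (*-cancel-≤ 1 (certify-≤ (≤⇒0≤- (proj₁ low-bounds) ⊕ <⇒0≤ (+<+ q<n) ⊕ lit 1)
    (ring 3 (λ l n q → n :+ q :- # 2 :* l :+ (n :- q :- # 1) :+ # 1 := # 2 :* n :- # 2 :* l) (+ lowA n ∷ N ∷ + q ∷ []))))

  high≤n : highA n ℕ.≤ n
  high≤n = ℕₚ.≤-pred (ℤₚ.drop‿+<+ (*-cancel-< 1 (certify-< 0 (≤⇒0≤- (proj₁ high-bounds) ⊕ ≤⇒0≤- r≤1+q ⊕ <⇒0≤ (+<+ q<n))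
    (trans (ring 4 (λ h n q r → n :+ r :+ # 1 :- # 2 :* h :+ (# 1 :+ q :- r) :+ (n :- q :- # 1) :+ # 1
        := # 2 :* (# 1 :+ n) :- # 2 :* h) (+ highA n ∷ N ∷ + q ∷ + r ∷ []))
      (cong (λ z → + 2 * z - + 2 * + highA n) (sym (pos-suc n)))))))

  private
    -- No integer lies strictly between the two candidates, so every part size is at most the lower
    -- one or at least the upper one. The argument is `2 highA ≤ n + r + 1 ≤ n + q + 2 ≤ 2 lowA +
    -- 3`, followed by parity.
    high≤1+low : highA n ℕ.≤ suc (lowA n)
    high≤1+low = ℕₚ.≤-pred (ℤₚ.drop‿+<+ (*-cancel-< 1 (certify-< 0 (≤⇒0≤- (proj₁ high-bounds) ⊕ ≤⇒0≤- r≤1+q ⊕ ≤⇒0≤- (proj₂ low-bounds))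
      (trans (ring 5 (λ l h n q r → n :+ r :+ # 1 :- # 2 :* h :+ (# 1 :+ q :- r) :+ (# 2 :* l :+ # 1 :- (n :+ q)) :+ # 1
          := # 2 :* (# 2 :+ l) :- # 2 :* h) (+ lowA n ∷ + highA n ∷ N ∷ + q ∷ + r ∷ []))
        (cong (λ z → + 2 * z - + 2 * + highA n) (sym (pos-+ 2 (lowA n))))))))

  -- The squares of the two candidate imbalances lie on either side of the peak `M`, and the square
  -- is increasing for nonnegative imbalance. A smaller part size therefore loses to the lower
  -- candidate and a larger one to the upper candidate.
  value-cases : ∀ a → 0ℤ ≤ imbalance n a →
    (value a < value (lowA n) ⊎ value a < value (highA n)) ⊎ (a ≡ lowA n ⊎ a ≡ highA n)
  value-cases a 0≤ta = compare (ℕₚ.<-cmp a (lowA n))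
    where
    Cases = (value a < value (lowA n) ⊎ value a < value (highA n)) ⊎ (a ≡ lowA n ⊎ a ≡ highA n)

    above : highA n ℕ.< a ⊎ highA n ≡ a → Cases
    above (inj₁ high<a) = inj₁ (inj₂ (profile-decreasing (square-gap (ℤₚ.≤-trans (lit r) r≤t-high) high<a) M≤high²))
    above (inj₂ high≡a) = inj₂ (inj₂ (sym high≡a))

    compare : Tri (a ℕ.< lowA n) (a ≡ lowA n) (lowA n ℕ.< a) → Cases
    compare (tri< a<low _ _) = inj₁ (inj₁ (profile-increasing (square-gap 0≤ta a<low) low²≤M))
    compare (tri≈ _ a≡low _) = inj₂ (inj₁ a≡low)
    compare (tri> _ _ low<a) = above (ℕₚ.m≤n⇒m<n∨m≡n (ℕₚ.≤-trans high≤1+low low<a))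

  private
    0≤M : 0ℤ ≤ M
    0≤M = ℤₚ.≤-trans (square (+ q)) q²≤M

  -- Ensures that a colouring with negative excess stays strictly below the optimum, since the
  -- optimum is then at least `leading N / 32`.
  value-low-nonneg : 0ℤ ≤ value (lowA n)
  value-low-nonneg = subst (0ℤ ≤_)
    (ring 2 (λ n u → # 2 :* u :* (# 3 :* n :- # 4 :- u) :+ # 2 :* u :* (# 3 :* n :- # 4) := :- (# 2 :* u :* u) :+ (# 12 :* n :- # 16) :* u)
      (N ∷ t (lowA n) * t (lowA n) ∷ []))
    (lit 2 ⊗ square (t (lowA n)) ⊗ ≤⇒0≤- low²≤M ⊕ lit 2 ⊗ square (t (lowA n)) ⊗ 0≤M)

  bound-strict : ∀ {a b} → a ℕ.≤ n → b ℕ.≤ n → value a < value b → bound n a ℕ.< bound n b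
  bound-strict {a} {b} a≤n b≤n a<b = ℤₚ.drop‿+<+ (*-cancel-< 31 (subst₂ _<_ (sym (bound-profile n a a≤n)) (sym (bound-profile n b b≤n))
    (+-mono-≤-< ℤₚ.≤-refl a<b)))

  -- This is the set `A` of the theorem: whichever candidate has the larger bound, and both of them
  -- in case of a tie.
  Optimal : ℕ → Set
  Optimal a = (a ≡ lowA n ⊎ a ≡ highA n) × bound n (lowA n) ℕ.≤ bound n a × bound n (highA n) ℕ.≤ bound n a

  optimal : ∃ Optimal
  optimal with ℕₚ.≤-total (bound n (lowA n)) (bound n (highA n))
  ... | inj₁ low≤high = highA n , inj₂ refl , low≤high , ℕₚ.≤-refl
  ... | inj₂ high≤low = lowA n , inj₁ refl , ℕₚ.≤-refl , high≤low

  optimal≤n : ∀ {a} → Optimal a → a ℕ.≤ n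
  optimal≤n (inj₁ refl , _) = low≤n
  optimal≤n (inj₂ refl , _) = high≤n

  optimal-≤ : ∀ {a b} → Optimal a → Optimal b → bound n a ℕ.≤ bound n b
  optimal-≤ (inj₁ refl , _) (_ , low≤ , _) = low≤
  optimal-≤ (inj₂ refl , _) (_ , _ , high≤) = high≤

  optimal-maximal : ∀ {a} → Optimal a → ∀ b → b ℕ.≤ n → 0ℤ ≤ imbalance n b →
    bound n b ℕ.< bound n a ⊎ (bound n b ≡ bound n a × Optimal b)
  optimal-maximal {a} (a-side , low≤ , high≤) b b≤n 0≤tb = compare (value-cases b 0≤tb)
    where
    b≤a : b ≡ lowA n ⊎ b ≡ highA n → bound n b ℕ.≤ bound n a
    b≤a (inj₁ refl) = low≤
    b≤a (inj₂ refl) = high≤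

    tie : b ≡ lowA n ⊎ b ≡ highA n → bound n b ℕ.< bound n a ⊎ bound n b ≡ bound n a →
      bound n b ℕ.< bound n a ⊎ (bound n b ≡ bound n a × Optimal b)
    tie b-side (inj₁ b<a) = inj₁ b<a
    tie b-side (inj₂ b≡a) = inj₂ (b≡a , b-side , subst (bound n (lowA n) ℕ.≤_) (sym b≡a) low≤ , subst (bound n (highA n) ℕ.≤_) (sym b≡a) high≤)

    compare : (value b < value (lowA n) ⊎ value b < value (highA n)) ⊎ (b ≡ lowA n ⊎ b ≡ highA n) →
      bound n b ℕ.< bound n a ⊎ (bound n b ≡ bound n a × Optimal b)
    compare (inj₁ (inj₁ b<low)) = inj₁ (ℕₚ.<-≤-trans (bound-strict b≤n low≤n b<low) low≤)
    compare (inj₁ (inj₂ b<high)) = inj₁ (ℕₚ.<-≤-trans (bound-strict b≤n high≤n b<high) high≤)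
    compare (inj₂ b-side) = tie b-side (ℕₚ.m≤n⇒m<n∨m≡n (b≤a b-side))

  leading≤bound : ∀ {a} → Optimal a → leading N ≤ + 32 * + bound n a
  leading≤bound {a} (_ , low≤ , _) = ℤₚ.≤-trans
    (certify-≤ value-low-nonneg (trans (ring 2 (λ l v → v := l :+ v :- l) (leading N ∷ value (lowA n) ∷ [])) (cong (λ z → z - leading N) (sym (bound-profile n _ low≤n)))))
    (certify-≤ (lit 32 ⊗ ≤⇒0≤- (+≤+ low≤)) (ring 2 (λ b c → # 32 :* (c :- b) := # 32 :* c :- # 32 :* b) (+ bound n (lowA n) ∷ + bound n a ∷ [])))

  private
    pos-^ : ∀ k → + (n ℕ.^ suc k) ≡ N * + (n ℕ.^ k)
    pos-^ k = pos-* n (n ℕ.^ k)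

    n³≡ : + (n ℕ.^ 3) ≡ N * (N * (N * 1ℤ))
    n³≡ = trans (pos-^ 2) (cong (N *_) (trans (pos-^ 1) (cong (N *_) (pos-^ 0))))

    n⁴≡ : + (n ℕ.^ 4) ≡ N * (N * (N * (N * 1ℤ)))
    n⁴≡ = trans (pos-^ 3) (cong (N *_) n³≡)

    value≤ : ∀ a → value a ≤ + 2 * M * M
    value≤ a = certify-≤ (lit 2 ⊗ square (t a * t a - M))
      (ring 2 (λ n u → # 2 :* ((u :- (# 3 :* n :- # 4)) :* (u :- (# 3 :* n :- # 4)))
        := # 2 :* (# 3 :* n :- # 4) :* (# 3 :* n :- # 4) :- (:- (# 2 :* u :* u) :+ (# 12 :* n :- # 16) :* u)) (N ∷ t a * t a ∷ []))

  -- The excess is at most `2 M²`, which is only quadratic in `n`, so the sole cubic term is the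
  -- `- 12 n³` of `leading`. The constant 40 leaves ample room here and in `bound-lower`.
  bound-upper : ∀ {a} → Optimal a → 16 ℕ.* bound n a ℕ.≤ n ℕ.^ 4 ℕ.+ 40 ℕ.* n ℕ.^ 3
  bound-upper {a} opt = ℤₚ.drop‿+≤+ (*-cancel-≤ 1 (subst₂ _≤_ lhs rhs
    (certify-≤ (≤⇒0≤- (value≤ a) ⊕ lit 34 ⊗ lit n ⊗ lit n ⊗ gap large 1 ⊕ lit 58 ⊗ lit n ⊗ lit n ⊗ lit n ⊕ lit 48 ⊗ gap large 1 ⊕ lit 16)
      (ring 2 (λ n v → # 2 :* (# 3 :* n :- # 4) :* (# 3 :* n :- # 4) :- v :+ # 34 :* n :* n :* (n :- # 1)
          :+ # 58 :* n :* n :* n :+ # 48 :* (n :- # 1) :+ # 16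
        := # 2 :* (n :* (n :* (n :* (n :* # 1))) :+ # 40 :* (n :* (n :* (n :* # 1))))
          :- (# 2 :* n :* n :* n :* n :- # 12 :* n :* n :* n :+ # 16 :* n :* n :+ v)) (N ∷ value a ∷ [])))))
    where
    lhs : leading N + value a ≡ + 2 * + (16 ℕ.* bound n a)
    lhs = trans (sym (bound-profile n a (optimal≤n opt)))
      (trans (ring 1 (λ b → # 32 :* b := # 2 :* (# 16 :* b)) (+ bound n a ∷ [])) (cong (+ 2 *_) (sym (pos-* 16 _))))
    rhs : + 2 * (N * (N * (N * (N * 1ℤ))) + + 40 * (N * (N * (N * 1ℤ)))) ≡ + 2 * + (n ℕ.^ 4 ℕ.+ 40 ℕ.* n ℕ.^ 3)
    rhs = cong (+ 2 *_) (sym (trans (pos-+ (n ℕ.^ 4) _) (cong₂ _+_ n⁴≡ (trans (pos-* 40 _) (cong (+ 40 *_) n³≡)))))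

  bound-lower : ∀ {a} → Optimal a → n ℕ.^ 4 ℕ.≤ 16 ℕ.* bound n a ℕ.+ 40 ℕ.* n ℕ.^ 3
  bound-lower {a} opt = ℤₚ.drop‿+≤+ (*-cancel-≤ 1 (subst₂ _≤_ (cong (+ 2 *_) (sym n⁴≡)) rhs
    (certify-≤ (≤⇒0≤- (leading≤bound opt) ⊕ lit 68 ⊗ lit n ⊗ lit n ⊗ lit n ⊕ lit 16 ⊗ lit n ⊗ lit n)
      (ring 2 (λ n b → # 32 :* b :- (# 2 :* n :* n :* n :* n :- # 12 :* n :* n :* n :+ # 16 :* n :* n) :+ # 68 :* n :* n :* n :+ # 16 :* n :* n
        := # 2 :* (# 16 :* b :+ # 40 :* (n :* (n :* (n :* # 1)))) :- # 2 :* (n :* (n :* (n :* (n :* # 1)))))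
        (N ∷ + bound n a ∷ [])))))
    where
    rhs : + 2 * (+ 16 * + bound n a + + 40 * (N * (N * (N * 1ℤ)))) ≡ + 2 * + (16 ℕ.* bound n a ℕ.+ 40 ℕ.* n ℕ.^ 3)
    rhs = cong (+ 2 *_) (sym (trans (pos-+ (16 ℕ.* bound n a) _) (cong₂ _+_ (pos-* 16 _) (trans (pos-* 40 _) (cong (+ 40 *_) n³≡)))))

-- Bipartite colourings

sideSign : Bool → ℤ
sideSign true = 1ℤ
sideSign false = -1ℤ

sideSign-sign : ∀ b → IsSign (sideSign b)
sideSign-sign true = plus
sideSign-sign false = minus

sideSign-not : ∀ b → sideSign (not b) ≡ - sideSign b
sideSign-not true = ring 0 (con -1ℤ := :- # 1) []
sideSign-not false = ring 0 (# 1 := :- con -1ℤ) []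

sideSign-same : ∀ {a b} → a ≡ b → sideSign a * sideSign b ≡ 1ℤ
sideSign-same {a} refl = sign-square (sideSign-sign a)

sideSign-different : ∀ {a b} → a ≢ b → sideSign a * sideSign b ≡ -1ℤ
sideSign-different {true} {true} a≢b = contradiction refl a≢b
sideSign-different {true} {false} _ = ring 0 (# 1 :* con -1ℤ := con -1ℤ) []
sideSign-different {false} {true} _ = ring 0 (con -1ℤ :* # 1 := con -1ℤ) []
sideSign-different {false} {false} a≢b = contradiction refl a≢b

sum-sideSign : ∀ {n} (S : Fin n → Bool) → sum (λ i → sideSign (S i)) ≡ imbalance n (sideSize S)
sum-sideSign {n} S = trans (sum-cong λ i → pointwise (S i))
  (trans (sum-minus (λ i → + 2 * + indicator (S i)) λ _ → 1ℤ)
    (cong₂ _-_ (trans (sum-*ˡ (+ 2) _) (cong (+ 2 *_) (sym (list-sum _))))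
      (trans (sum-const n 1ℤ) (ring 1 (λ n → n :* # 1 := n) (+ n ∷ [])))))
  where
  pointwise : ∀ b → sideSign b ≡ + 2 * + indicator b - 1ℤ
  pointwise true = ring 0 (# 1 := # 2 :* # 1 :- # 1) []
  pointwise false = ring 0 (con -1ℤ := # 2 :* # 0 :- # 1) []

sideSize≤ : ∀ {n} (S : Fin n → Bool) → sideSize S ℕ.≤ n
sideSize≤ {n} S = ℤₚ.drop‿+≤+ (subst₂ _≤_ (sym (list-sum _)) (trans (sum-const n 1ℤ) (ring 1 (λ n → n :* # 1 := n) (+ n ∷ [])))
  (sum-mono λ i → pointwise (S i)))
  where
  pointwise : ∀ b → + indicator b ≤ 1ℤ
  pointwise true = ℤₚ.≤-refl
  pointwise false = +≤+ z≤n

-- A sign vector and its negative give the same rank one matrix. The representative with nonnegative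
-- sum is taken, so that `side` marks the larger part, as the comparison with the candidates
-- requires.
record Sides {n} (s : Fin n → ℤ) : Set where
  field
    side : Fin n → Bool
    products : ∀ i j → s i * s j ≡ sideSign (side i) * sideSign (side j)
    total-square : sum s * sum s ≡ imbalance n (sideSize side) * imbalance n (sideSize side)
    larger-side : 0ℤ ≤ imbalance n (sideSize side)

sides : ∀ {n} (s : Fin n → ℤ) → (∀ i → IsSign (s i)) → Sides s
sides {n} s s-sign = orient (ℤₚ.≤-total 0ℤ (sum s))
  where
  positive : ∀ {z} → IsSign z → Bool
  positive plus = true
  positive minus = false

  positive-sign : ∀ {z} (p : IsSign z) → z ≡ sideSign (positive p)
  positive-sign plus = refl
  positive-sign minus = refl

  S : Fin n → Bool
  S i = positive (s-sign i)

  s≡ : ∀ i → s i ≡ sideSign (S i)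
  s≡ i = positive-sign (s-sign i)

  total≡ : sum s ≡ imbalance n (sideSize S)
  total≡ = trans (sum-cong s≡) (sum-sideSign S)

  opposite≡ : - sum s ≡ imbalance n (sideSize (λ i → not (S i)))
  opposite≡ = trans (trans (ring 1 (λ a → :- a := con -1ℤ :* a) (sum s ∷ [])) (sym (sum-*ˡ -1ℤ s)))
    (trans (sum-cong λ i → trans (trans (ring 1 (λ a → con -1ℤ :* a := :- a) (s i ∷ [])) (cong (λ z → - z) (s≡ i))) (sym (sideSign-not (S i))))
      (sum-sideSign λ i → not (S i)))

  orient : 0ℤ ≤ sum s ⊎ sum s ≤ 0ℤ → Sides s
  orient (inj₁ 0≤) = record
    { side = S
    ; products = λ i j → cong₂ _*_ (s≡ i) (s≡ j)
    ; total-square = cong₂ _*_ total≡ total≡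
    ; larger-side = subst (0ℤ ≤_) total≡ 0≤ }
  orient (inj₂ ≤0) = record
    { side = λ i → not (S i)
    ; products = λ i j → trans (ring 2 (λ a b → a :* b := :- a :* :- b) (s i ∷ s j ∷ []))
        (cong₂ _*_ (trans (cong (λ z → - z) (s≡ i)) (sym (sideSign-not (S i)))) (trans (cong (λ z → - z) (s≡ j)) (sym (sideSign-not (S j)))))
    ; total-square = trans (ring 1 (λ a → a :* a := :- a :* :- a) (sum s ∷ [])) (cong₂ _*_ opposite≡ opposite≡)
    ; larger-side = subst (0ℤ ≤_) opposite≡ (certify-≤ (≤⇒0≤- ≤0) (ring 1 (λ a → # 0 :- a := :- a :- # 0) (sum s ∷ []))) }

boolSign-disagree : ∀ d b → boolSign d b ≡ -1ℤ → b ≡ not d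
boolSign-disagree true false _ = refl
boolSign-disagree false true _ = refl

boolSign-not : ∀ d → boolSign d (not d) ≡ -1ℤ
boolSign-not true = refl
boolSign-not false = refl

boolSign-≢ : ∀ d b → b ≢ not d → boolSign d b ≡ 1ℤ
boolSign-≢ true true _ = refl
boolSign-≢ false false _ = refl
boolSign-≢ true false b≢ = contradiction refl b≢
boolSign-≢ false true b≢ = contradiction refl b≢

-- The upper bound and the extremal colourings

module Extremal {m} (large : + 100000 ≤ + suc m) (c : Colouring (suc m)) (c-sym : Symmetric c) where

  private
    n = suc m
  open Optimum n large
  open Agreement c c-sym

  bipartite-count : ∀ {a} → a ℕ.≤ n → OneColourBipartite c a → rrbbCount c ≡ bound n a
  bipartite-count {a} a≤n (b , S , size≡ , c≡b⇔) = ℤₚ.+-injective (*-cancel-≡ 31 (trans (rrbbCount-excess d)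
    (trans (cong (λ z → leading (+ n) + z) (trans
        (SignMatrix.rank-one-excess (agree d) (agree-sign d) (agree-sym d) (λ i → sideSign (S i)) (λ i → sideSign-sign (S i)) agree≡)
        (cong (λ z → profile (+ n) (z * z)) (trans (sum-sideSign S) (cong (imbalance n) size≡)))))
      (sym (bound-profile n a a≤n)))))
    where
    -- Colour `b` joins the two sides, so agreement with the opposite colour is the positive sign
    -- inside each side, and the diagonal fits as well.
    d = not b
    agree≡ : ∀ i j → agree d i j ≡ sideSign (S i) * sideSign (S j)
    agree≡ i j = by-cases (i Fin.≟ j) (S i Bool.≟ S j)
      where
      by-cases : Dec (i ≡ j) → Dec (S i ≡ S j) → agree d i j ≡ sideSign (S i) * sideSign (S j)
      by-cases (yes refl) _ = trans (agree-diag d i) (sym (sideSign-same {S i} refl))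
      by-cases (no i≢j) (yes same) = trans (agree-off d i≢j) (trans
        (boolSign-≢ d (c i j) λ c≡ → proj₁ (c≡b⇔ i j i≢j) (trans c≡ (Boolₚ.not-involutive b)) same) (sym (sideSign-same same)))
      by-cases (no i≢j) (no different) = trans (agree-off d i≢j) (trans
        (cong (boolSign d) (trans (proj₂ (c≡b⇔ i j i≢j) different) (sym (Boolₚ.not-involutive b))))
        (trans (boolSign-not d) (sym (sideSign-different different))))

  private
    d = proj₁ majority
    module R = Stability (agree d) (agree-sign d) (agree-sym d) large (proj₂ majority)
    open Sides (sides (agree d R.pivot) (agree-sign d R.pivot))

    a′ : ℕ
    a′ = sideSize side

    profile≡ : profile (+ n) (Matrix.deg d R.pivot * Matrix.deg d R.pivot) ≡ value a′
    profile≡ = cong (profile (+ n)) total-square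

    count<bound : excessOf d < value a′ → rrbbCount c ℕ.< bound n a′
    count<bound lt = ℤₚ.drop‿+<+ (*-cancel-< 31 (subst₂ _<_ (sym (rrbbCount-excess d)) (sym (bound-profile n a′ (sideSize≤ side)))
      (+-mono-≤-< ℤₚ.≤-refl lt)))

    bipartite : (∀ i j → agree d i j ≡ agree d R.pivot i * agree d R.pivot j) → OneColourBipartite c a′
    bipartite agree≡ = not d , side , refl , λ i j i≢j → forward i j i≢j , backward i j i≢j
      where
      sign≡ : ∀ i j → i ≢ j → boolSign d (c i j) ≡ sideSign (side i) * sideSign (side j)
      sign≡ i j i≢j = trans (sym (agree-off d i≢j)) (trans (agree≡ i j) (products i j))
      forward : ∀ i j → i ≢ j → c i j ≡ not d → side i ≢ side j
      forward i j i≢j c≡ same = 1≢-1 (trans (sym (sideSign-same same)) (trans (sym (sign≡ i j i≢j)) (trans (cong (boolSign d) c≡) (boolSign-not d))))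
        where
        1≢-1 : 1ℤ ≢ -1ℤ
        1≢-1 ()
      backward : ∀ i j → i ≢ j → side i ≢ side j → c i j ≡ not d
      backward i j i≢j different = boolSign-disagree d (c i j) (trans (sign≡ i j i≢j) (sideSign-different different))

  -- Strict inequality, or equality together with the structure: this form yields both the bound and
  -- the characterisation of equality. Off rank one, the count is below that of a bipartite
  -- colouring whose sides are the two signs of the pivot row, or its excess is negative; in the
  -- rank one case the colouring is itself bipartite, and only its part size is in question.
  upper : ∀ {a} → Optimal a → rrbbCount c ℕ.< bound n a ⊎ (rrbbCount c ≡ bound n a × Σ ℕ λ b → Optimal b × OneColourBipartite c b)

  upper {a} opt = from R.dichotomy
    where
    Result = rrbbCount c ℕ.< bound n a ⊎ (rrbbCount c ≡ bound n a × Σ ℕ λ b → Optimal b × OneColourBipartite c b)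
    best : bound n a′ ℕ.< bound n a ⊎ (bound n a′ ≡ bound n a × Optimal a′)
    best = optimal-maximal opt a′ (sideSize≤ side) larger-side

    best≤ : ∀ {k l : ℕ} {P : Set} → k ℕ.< l ⊎ (k ≡ l × P) → k ℕ.≤ l
    best≤ (inj₁ k<l) = ℕₚ.<⇒≤ k<l
    best≤ (inj₂ (refl , _)) = ℕₚ.≤-refl

    from-bipartite : OneColourBipartite c a′ → bound n a′ ℕ.< bound n a ⊎ (bound n a′ ≡ bound n a × Optimal a′) → Result
    from-bipartite bip (inj₁ lt) = inj₁ (subst (ℕ._< bound n a) (sym (bipartite-count (sideSize≤ side) bip)) lt)
    from-bipartite bip (inj₂ (eq , opt′)) = inj₂ (trans (bipartite-count (sideSize≤ side) bip) eq , a′ , opt′ , bip)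

    from : (excessOf d < 0ℤ ⊎ excessOf d < profile (+ n) (Matrix.deg d R.pivot * Matrix.deg d R.pivot))
      ⊎ (∀ i j → agree d i j ≡ agree d R.pivot i * agree d R.pivot j) → Result
    from (inj₁ (inj₁ G<0)) = inj₁ (ℤₚ.drop‿+<+ (*-cancel-< 31 (ℤₚ.<-≤-trans
      (subst₂ _<_ (sym (rrbbCount-excess d)) (ring 1 (λ l → l :+ # 0 := l) (leading (+ n) ∷ [])) (+-mono-≤-< ℤₚ.≤-refl G<0))
      (leading≤bound opt))))
    from (inj₁ (inj₂ G<)) = inj₁ (ℕₚ.<-≤-trans (count<bound (subst (excessOf d <_) profile≡ G<)) (best≤ best))
    from (inj₂ agree≡) = from-bipartite (bipartite agree≡) best

  maximum : ∀ {a} → Optimal a → rrbbCount c ℕ.≤ bound n a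
  maximum {a} opt = weaken (upper opt)
    where
    weaken : ∀ {P : Set} → rrbbCount c ℕ.< bound n a ⊎ (rrbbCount c ≡ bound n a × P) → rrbbCount c ℕ.≤ bound n a
    weaken (inj₁ lt) = ℕₚ.<⇒≤ lt
    weaken (inj₂ (eq , _)) = ℕₚ.≤-reflexive eq

  -- The part size `b` may differ from `a` when both candidates are optimal. For the converse, all
  -- members of `Optimal` have the same bound, by `optimal-≤` in both directions.
  attained : ∀ {a} → Optimal a → (rrbbCount c ≡ bound n a) ⇔ (Σ ℕ λ b → Optimal b × OneColourBipartite c b)
  attained {a} opt = mk⇔ (λ eq → extremal eq (upper opt)) λ (b , opt′ , bip) →
    trans (bipartite-count (optimal≤n opt′) bip) (ℕₚ.≤-antisym (optimal-≤ opt′ opt) (optimal-≤ opt opt′))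
    where
    extremal : ∀ {P : Set} → rrbbCount c ≡ bound n a → rrbbCount c ℕ.< bound n a ⊎ (rrbbCount c ≡ bound n a × P) → P
    extremal eq (inj₁ lt) = contradiction eq (ℕₚ.<⇒≢ lt)
    extremal eq (inj₂ (_ , p)) = p

theorem1p7 : Σ ℕ λ n₀ → Σ ℕ λ C → (n : ℕ) → n₀ ℕ.≤ n →
    Σ (ℕ → Set) λ A →
    ((a : ℕ) → A a → (a ≡ lowA n) ⊎ (a ≡ highA n)) ×
    (Σ ℕ λ a → A a) ×
    ((a : ℕ) → A a →
    ((c : Colouring n) → Symmetric c → rrbbCount c ℕ.≤ bound n a) ×
    ((c : Colouring n) → Symmetric c →
    (rrbbCount c ≡ bound n a) ⇔ (Σ ℕ λ a′ → A a′ × OneColourBipartite c a′)) ×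
    (16 ℕ.* bound n a ℕ.≤ n ℕ.^ 4 ℕ.+ C ℕ.* n ℕ.^ 3) ×
    (n ℕ.^ 4 ℕ.≤ 16 ℕ.* bound n a ℕ.+ C ℕ.* n ℕ.^ 3))
theorem1p7 = 100000 , 40 , λ where
  zero ()
  (suc m) n-large → let large = +≤+ n-large in
    Optimum.Optimal _ large , (λ a → proj₁) , Optimum.optimal _ large , λ a opt →
      (λ c c-sym → Extremal.maximum large c c-sym opt) , (λ c c-sym → Extremal.attained large c c-sym opt) ,
      Optimum.bound-upper _ large opt , Optimum.bound-lower _ large opt
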